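{- Let $\mathbf A\in K(\mathsf{SRL})$ be finite and subdirectly irreducible. Then $\mathbb V(\mathbf A)$ is a cover of $\mathbb V(\mathbf K_8)$ but not of $\mathbb V(\mathbf K_4)=K(\mathsf{BA})$ if and only if $\mathbf A\cong K_0(\mathbf 2\oplus\mathbf D)$ for some finite subdirectly irreducible $\mathbf D\in\mathsf{CIRL}$ that generates a cover of $\mathbb V(\mathbf 2)$ (the variety of generalized Boolean algebras) in the lattice of subvarieties of $\mathsf{CIRL}$.
   Context: $\mathsf{CIRL}$: commutative integral residuated lattices $(A,\vee,\wedge,\cdot,\to,1)$ (lattice, commutative monoid, $ab\le c$ iff $a\le b\to c$, $1$ greatest). $\mathsf{BCRL}$: members of $\mathsf{CIRL}$ with an extra constant $0$ that is the least element; $\neg x:=x\to0$. $\mathsf{SRL}$: the subvariety of $\mathsf{BCRL}$ defined by $\neg x\vee\neg\neg x=1$. For $\mathbf D\in\mathsf{CIRL}$, $\mathbf 2\oplus\mathbf D\in\mathsf{BCRL}$ has universe $\{0\}\cup D$ with $0$ below every element of $D$, $0\cdot x=0$, $0\to x=1$, $x\to0=0$ for $x\in D$, and product and implication of $D$ on $D$. For $\mathbf A\in\mathsf{BCRL}$, $K(\mathbf A)$ is the algebra on $A\times A$ with $(a,b)\vee(c,d)=(a\vee c,b\wedge d)$, $(a,b)\wedge(c,d)=(a\wedge c,b\vee d)$, $(a,b)(c,d)=(ac,(a\to d)\wedge(c\to b))$, $(a,b)\to(c,d)=((a\to c)\wedge(d\to b),ad)$, unit $(1,1)$, constant $0$ as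 $(0,1)$. With $\sim x:=x\to1$, a bounded K-lattice is a commutative residuated lattice with extra constant $0\le x$ satisfying $\sim\sim x=x$, the lattice distributive laws whenever one of the three elements is $1$, and $xy\wedge 1=(x\wedge1)(y\wedge1)$, $((x\wedge1)\to y)\wedge((\sim y\wedge 1)\to\sim x)=x\to y$. For such $\mathbf A$, $\mathbf A^-$ is the algebra on $\{a\le1\}$ with the same $\vee,\wedge,\cdot,0,1$ and $a\to^-b=(a\to b)\wedge1$; $K(\mathsf{SRL})$ is the class of bounded K-lattices $\mathbf A$ with $\mathbf A^-\in\mathsf{SRL}$. A subalgebra $\mathbf S$ of a bounded K-lattice $\mathbf A$ is admissible if $S^-=A^-$; $K_0(\mathbf B)$ is the smallest admissible subalgebra of $K(\mathbf B)$. $\mathbf 2$ is the two-element Boolean algebra (resp. generalized Boolean algebra in $\mathsf{CIRL}$), $\mathbf K_4=K(\mathbf 2)$, $\mathbf K_8=K_0(\mathbf2\oplus\mathbf2)$. -}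

module Defs where

open import Data.Nat using (ℕ)
open import Data.Bool using (Bool; true; false; not) renaming (_∨_ to _∨ᵇ_; _∧_ to _∧ᵇ_)
open import Data.Unit using (⊤; tt)
open import Data.Maybe using (Maybe; just; nothing)
open import Data.Product using (Σ; _×_; _,_; proj₁; proj₂; ∃)
open import Data.Sum using (_⊎_)
open import Data.Fin using (Fin)
open import Data.Empty using (⊥)
open import Relation.Nullary using (¬_)
open import Relation.Binary.PropositionalEquality using (_≡_; _≢_)
open import Function.Bundles using (_↔_)

-- Signatures.  b = false : language of CIRL  (∨, ∧, ·, →, 1)
--              b = true  : language with an extra constant 0
--                          (BCRL, bounded K-lattices)

Const0 : Bool → Set → Set
Const0 false X = ⊤
Const0 true  X = X

record Alg (b : Bool) : Set₁ where
  infixr 6 _⊔_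
  infixr 7 _⊓_
  infixr 8 _·_
  infixr 5 _⇒_
  field
    Carrier : Set
    _⊔_ _⊓_ _·_ _⇒_ : Carrier → Carrier → Carrier
    e : Carrier
    z : Const0 b Carrier

data Term : Bool → Set where
  var  : ∀ {b} → ℕ → Term b
  _∨ₜ_ _∧ₜ_ _·ₜ_ _⇒ₜ_ : ∀ {b} → Term b → Term b → Term b
  oneₜ : ∀ {b} → Term b
  zerₜ : Term true

Identity : Bool → Set
Identity b = Term b × Term b

eval : ∀ {b} (A : Alg b) → (ℕ → Alg.Carrier A) → Term b → Alg.Carrier A
eval A ρ (var i)    = ρ i
eval A ρ (s ∨ₜ t)   = Alg._⊔_ A (eval A ρ s) (eval A ρ t)
eval A ρ (s ∧ₜ t)   = Alg._⊓_ A (eval A ρ s) (eval A ρ t)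
eval A ρ (s ·ₜ t)   = Alg._·_ A (eval A ρ s) (eval A ρ t)
eval A ρ (s ⇒ₜ t)   = Alg._⇒_ A (eval A ρ s) (eval A ρ t)
eval A ρ oneₜ       = Alg.e A
eval A ρ zerₜ       = Alg.z A

Sat : ∀ {b} (A : Alg b) → Identity b → Set
Sat A (s , t) = ∀ ρ → eval A ρ s ≡ eval A ρ t

-- identities of the subalgebra of A whose universe is P (P assumed closed
-- under the operations): evaluate with assignments into P.
SatSub : ∀ {b} (A : Alg b) → (Alg.Carrier A → Set) → Identity b → Set
SatSub A P (s , t) = ∀ ρ → (∀ i → P (ρ i)) → eval A ρ s ≡ eval A ρ t

-- Varieties.  A variety generated by an algebra is represented by its
-- equational theory T (V(A) = Mod(Th A)); an arbitrary variety by a set Σ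
-- of identities (W = Mod Σ).

Mod : ∀ {b} → (Identity b → Set) → Alg b → Set
Mod Σ' C = ∀ ε → Σ' ε → Sat C ε

CoversV : ∀ {b} → (TA TB : Identity b → Set) → Set₁
CoversV {b} TA TB =
    (∀ ε → TA ε → TB ε)                                   -- V_B ⊆ V_A
  × ¬ (∀ ε → TB ε → TA ε)                                 -- V_A ⊈ V_B
  × (∀ (Σ' : Identity b → Set)
       → (∀ ε → Σ' ε → TB ε)                              -- V_B ⊆ Mod Σ'
       → (∀ (C : Alg b) → Mod Σ' C → ∀ ε → TA ε → Sat C ε) -- Mod Σ' ⊆ V_A
       → (∀ (C : Alg b) → Mod Σ' C → ∀ ε → TB ε → Sat C ε) -- Mod Σ' = V_B
         ⊎ (∀ ε → Σ' ε → TA ε))                           -- or Mod Σ' = V_A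

Finite : ∀ {b} → Alg b → Set
Finite A = Σ ℕ λ n → Alg.Carrier A ↔ Fin n

module _ {b : Bool} (A : Alg b) where
  open Alg A

  record Cong : Set₁ where
    field
      θ      : Carrier → Carrier → Set
      refl'  : ∀ x → θ x x
      sym'   : ∀ {x y} → θ x y → θ y x
      trans' : ∀ {x y w} → θ x y → θ y w → θ x w
      ⊔-cong : ∀ {x x' y y'} → θ x x' → θ y y' → θ (x ⊔ y) (x' ⊔ y')
      ⊓-cong : ∀ {x x' y y'} → θ x x' → θ y y' → θ (x ⊓ y) (x' ⊓ y')
      ·-cong : ∀ {x x' y y'} → θ x x' → θ y y' → θ (x · y) (x' · y')
      ⇒-cong : ∀ {x x' y y'} → θ x x' → θ y y' → θ (x ⇒ y) (x' ⇒ y')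

  NonTrivialCong : Cong → Set
  NonTrivialCong c = Σ Carrier λ x → Σ Carrier λ y → Cong.θ c x y × x ≢ y

  SubdirectlyIrreducible : Set₁
  SubdirectlyIrreducible =
    Σ Cong λ μ → NonTrivialCong μ
      × (∀ (φ : Cong) → NonTrivialCong φ → ∀ x y → Cong.θ μ x y → Cong.θ φ x y)

  _≤_ : Carrier → Carrier → Set
  x ≤ y = x ⊓ y ≡ x

  record IsCommResLattice : Set where
    field
      ⊔-assoc : ∀ x y w → (x ⊔ y) ⊔ w ≡ x ⊔ (y ⊔ w)
      ⊓-assoc : ∀ x y w → (x ⊓ y) ⊓ w ≡ x ⊓ (y ⊓ w)
      ⊔-comm  : ∀ x y → x ⊔ y ≡ y ⊔ x
      ⊓-comm  : ∀ x y → x ⊓ y ≡ y ⊓ x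
      ⊔-absorbs-⊓ : ∀ x y → x ⊔ (x ⊓ y) ≡ x
      ⊓-absorbs-⊔ : ∀ x y → x ⊓ (x ⊔ y) ≡ x
      ·-assoc : ∀ x y w → (x · y) · w ≡ x · (y · w)
      ·-comm  : ∀ x y → x · y ≡ y · x
      ·-identity : ∀ x → e · x ≡ x
      residuation₁ : ∀ x y w → (x · y) ≤ w → x ≤ (y ⇒ w)
      residuation₂ : ∀ x y w → x ≤ (y ⇒ w) → (x · y) ≤ w

  IsCIRL : Set
  IsCIRL = IsCommResLattice × (∀ x → x ≤ e)

module _ (A : Alg true) where
  open Alg A

  ∼_ : Carrier → Carrier
  ∼ x = x ⇒ e

  record IsBoundedKLattice : Set where
    field
      isCRL   : IsCommResLattice A
      bottom  : ∀ x → _≤_ A z x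
      ∼∼      : ∀ x → ∼ (∼ x) ≡ x
      -- distributive laws whenever one of the three elements is 1
      dist₁ᵃ : ∀ y w → e ⊓ (y ⊔ w) ≡ (e ⊓ y) ⊔ (e ⊓ w)
      dist₁ᵇ : ∀ x w → x ⊓ (e ⊔ w) ≡ (x ⊓ e) ⊔ (x ⊓ w)
      dist₁ᶜ : ∀ x y → x ⊓ (y ⊔ e) ≡ (x ⊓ y) ⊔ (x ⊓ e)
      dist₂ᵃ : ∀ y w → e ⊔ (y ⊓ w) ≡ (e ⊔ y) ⊓ (e ⊔ w)
      dist₂ᵇ : ∀ x w → x ⊔ (e ⊓ w) ≡ (x ⊔ e) ⊓ (x ⊔ w)
      dist₂ᶜ : ∀ x y → x ⊔ (y ⊓ e) ≡ (x ⊔ y) ⊓ (x ⊔ e)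
      ·-neg  : ∀ x y → (x · y) ⊓ e ≡ (x ⊓ e) · (y ⊓ e)
      ⇒-split : ∀ x y → ((x ⊓ e) ⇒ y) ⊓ (((∼ y) ⊓ e) ⇒ (∼ x)) ≡ x ⇒ y

  -- the negation of A⁻ :  ¬⁻ x = x →⁻ 0 = (x → 0) ∧ 1
  ¬⁻_ : Carrier → Carrier
  ¬⁻ x = (x ⇒ z) ⊓ e

  -- A ∈ K(SRL): a bounded K-lattice whose negative cone A⁻ is in SRL,
  -- i.e. A⁻ satisfies ¬x ∨ ¬¬x = 1 (A⁻ ∈ BCRL holds for every bounded K-lattice).
  InKSRL : Set
  InKSRL = IsBoundedKLattice × (∀ x → _≤_ A x e → (¬⁻ x) ⊔ (¬⁻ (¬⁻ x)) ≡ e)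

-- 2 ⊕ D   (nothing = the new bottom 0)
2⊕ : Alg false → Alg true
2⊕ D = record
  { Carrier = Maybe C
  ; _⊔_ = jn ; _⊓_ = mt ; _·_ = ml ; _⇒_ = im
  ; e = just (Alg.e D) ; z = nothing }
  where
  C = Alg.Carrier D
  jn : Maybe C → Maybe C → Maybe C
  jn nothing y = y
  jn (just x) nothing = just x
  jn (just x) (just y) = just (Alg._⊔_ D x y)
  mt : Maybe C → Maybe C → Maybe C
  mt nothing y = nothing
  mt (just x) nothing = nothing
  mt (just x) (just y) = just (Alg._⊓_ D x y)
  ml : Maybe C → Maybe C → Maybe C
  ml nothing y = nothing
  ml (just x) nothing = nothing
  ml (just x) (just y) = just (Alg._·_ D x y)
  im : Maybe C → Maybe C → Maybe C
  im nothing y = just (Alg.e D)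
  im (just x) nothing = nothing
  im (just x) (just y) = just (Alg._⇒_ D x y)

K : Alg true → Alg true
K A = record
  { Carrier = C × C
  ; _⊔_ = λ { (a , b) (c , d) → (a ⊔ c , b ⊓ d) }
  ; _⊓_ = λ { (a , b) (c , d) → (a ⊓ c , b ⊔ d) }
  ; _·_ = λ { (a , b) (c , d) → (a · c , (a ⇒ d) ⊓ (c ⇒ b)) }
  ; _⇒_ = λ { (a , b) (c , d) → ((a ⇒ c) ⊓ (d ⇒ b) , a · d) }
  ; e = (e , e)
  ; z = (z , e) }
  where open Alg A; C = Carrier

data Sg (A : Alg true) (P : Alg.Carrier A → Set) : Alg.Carrier A → Set where
  gen  : ∀ {x} → P x → Sg A P x
  s⊔   : ∀ {x y} → Sg A P x → Sg A P y → Sg A P (Alg._⊔_ A x y)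
  s⊓   : ∀ {x y} → Sg A P x → Sg A P y → Sg A P (Alg._⊓_ A x y)
  s·   : ∀ {x y} → Sg A P x → Sg A P y → Sg A P (Alg._·_ A x y)
  s⇒   : ∀ {x y} → Sg A P x → Sg A P y → Sg A P (Alg._⇒_ A x y)
  sone : Sg A P (Alg.e A)
  szer : Sg A P (Alg.z A)

-- universe of K₀(B): the smallest admissible subalgebra of K(B), i.e. the
-- subalgebra generated by the negative cone K(B)⁻ = {x | x ≤ 1}.
K₀ : (B : Alg true) → Alg.Carrier (K B) → Set
K₀ B = Sg (K B) (λ x → _≤_ (K B) x (Alg.e (K B)))

record IsoToSub (A B : Alg true) (P : Alg.Carrier B → Set) : Set where
  field
    f    : Alg.Carrier A → Alg.Carrier B
    f-⊔  : ∀ x y → f (Alg._⊔_ A x y) ≡ Alg._⊔_ B (f x) (f y)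
    f-⊓  : ∀ x y → f (Alg._⊓_ A x y) ≡ Alg._⊓_ B (f x) (f y)
    f-·  : ∀ x y → f (Alg._·_ A x y) ≡ Alg._·_ B (f x) (f y)
    f-⇒  : ∀ x y → f (Alg._⇒_ A x y) ≡ Alg._⇒_ B (f x) (f y)
    f-e  : f (Alg.e A) ≡ Alg.e B
    f-z  : f (Alg.z A) ≡ Alg.z B
    inj  : ∀ x y → f x ≡ f y → x ≡ y
    into : ∀ x → P (f x)
    onto : ∀ y → P y → Σ (Alg.Carrier A) λ x → f x ≡ y

𝟚 : Alg false
𝟚 = record { Carrier = Bool ; _⊔_ = _∨ᵇ_ ; _⊓_ = _∧ᵇ_ ; _·_ = _∧ᵇ_
           ; _⇒_ = λ x y → not x ∨ᵇ y ; e = true ; z = tt }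

𝟚ᵇ : Alg true
𝟚ᵇ = record { Carrier = Bool ; _⊔_ = _∨ᵇ_ ; _⊓_ = _∧ᵇ_ ; _·_ = _∧ᵇ_
            ; _⇒_ = λ x y → not x ∨ᵇ y ; e = true ; z = false }

K₄ : Alg true
K₄ = K 𝟚ᵇ

ThK₈ : Identity true → Set
ThK₈ = SatSub (K (2⊕ 𝟚)) (K₀ (2⊕ 𝟚))

-- For A ∈ K(SRL), x ↦ (x ∧ 1 , ∼ x ∧ 1) embeds A in K(A⁻).  If A is subdirectly irreducible, 1 is
-- join-irreducible among the complemented elements of A⁻, so ¬ x ∨ ¬ ¬ x = 1 forces A⁻ = 2 ⊕ D with
-- D the set of dense elements.  Then A is K₀ (2 ⊕ D), or else it is all of K (2 ⊕ D); in the latter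
-- case A contains both K₈ and K₄, and V(K₈) ∨ V(K₄) lies strictly between V(K₈) and V(A).
--
-- Covers are compared by translating identities.  An identity of CIRL is relativised to the dense
-- elements of the negative cone.  Conversely, evaluating an identity in K₀ (2 ⊕ D) after fixing
-- which coordinates of the variables are 0 yields finitely many identities on D.  A member C of
-- V(K₀ (2 ⊕ D)) need not be subdirectly irreducible, but the complemented elements ¬ a and ¬ ¬ a
-- split it, one variable at a time, into factors where each coordinate is 0 or dense, so that
-- identities of K₀ (2 ⊕ E), for E the dense part of C, hold in C.
module Submission where

open import Defs
open import Axiom.UniquenessOfIdentityProofs.WithK using (uip)
open import Data.Bool using (Bool; true; false)
import Data.Bool.Properties as Bool
open import Data.Empty using (⊥)
open import Data.Fin using (Fin; zero; suc)
import Data.Fin.Properties as Fin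
open import Data.Maybe as Maybe using (Maybe; just; nothing)
open import Data.Maybe.Properties using (just-injective)
open import Data.Maybe.Relation.Binary.Pointwise as Pointwise using (Pointwise; just; nothing)
open import Data.Nat as ℕ using (ℕ; zero; suc)
import Data.Nat.Properties as ℕ
open import Data.Product as Prod using (Σ; ∃; _×_; _,_; proj₁; proj₂)
open import Data.Product.Function.Dependent.Propositional using (Σ-↔)
open import Data.Sum using (_⊎_; inj₁; inj₂)
open import Data.Unit using (⊤; tt)
open import Function.Bundles using (_⇔_; _↔_; mk⇔; mk↔ₛ′; Inverse)
open import Function.Construct.Composition using (_↔-∘_)
open import Function.Construct.Identity using (↔-id)
open import Function.Construct.Symmetry using (↔-sym)
open import Relation.Binary.PropositionalEquality
open import Relation.Nullary using (¬_; Dec; yes; no; contradiction)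
open import Relation.Nullary.Decidable using (map′; _×-dec_; ¬?; decidable-stable)

-- Homomorphisms and evaluation

-- `CoversV` quantifies over sets Γ of identities and over all models of Γ, which may be infinite
-- and without decidable equality, so intermediate varieties are not compared through their
-- subdirectly irreducible members. Γ itself is carried across instead, and the full theory of the
-- upper algebra is added each time so that the new variety stays below it. Each direction needs a
-- test algebra: `K₀-alg C` for a model `C` in the language of CIRL, `denseAlg` for a model `C` with
-- 0. The second is the delicate one, since 0 and the dense elements account only for a part of the
-- negative cone of `C`; congruences of finitely many idempotents take the place of a subdirect
-- decomposition. The pair (0 , 0) governs the rest: `K₄` contains it, `K₀ (2 ⊕ D)` does not, and
-- one identity detects it.

map₀ : ∀ b {X Y : Set} → (X → Y) → Const0 b X → Const0 b Y
map₀ false f _ = tt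
map₀ true  f x = f x

record Hom {b} (A B : Alg b) : Set where
  private
    module A = Alg A
    module B = Alg B
  field
    to    : A.Carrier → B.Carrier
    ⊔-hom : ∀ x y → to (x A.⊔ y) ≡ to x B.⊔ to y
    ⊓-hom : ∀ x y → to (x A.⊓ y) ≡ to x B.⊓ to y
    ·-hom : ∀ x y → to (x A.· y) ≡ to x B.· to y
    ⇒-hom : ∀ x y → to (x A.⇒ y) ≡ (to x B.⇒ to y)
    e-hom : to A.e ≡ B.e
    z-hom : map₀ b to A.z ≡ B.z

open Hom using (to)

Injective : ∀ {b} {A B : Alg b} → Hom A B → Set
Injective h = ∀ {x y} → to h x ≡ to h y → x ≡ y

_∘ₕ_ : ∀ {b} {A B C : Alg b} → Hom B C → Hom A B → Hom A C
_∘ₕ_ {b} g h = record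
  { to    = λ x → to g (to h x)
  ; ⊔-hom = λ x y → trans (cong (to g) (⊔-hom h x y)) (⊔-hom g _ _)
  ; ⊓-hom = λ x y → trans (cong (to g) (⊓-hom h x y)) (⊓-hom g _ _)
  ; ·-hom = λ x y → trans (cong (to g) (·-hom h x y)) (·-hom g _ _)
  ; ⇒-hom = λ x y → trans (cong (to g) (⇒-hom h x y)) (⇒-hom g _ _)
  ; e-hom = trans (cong (to g) (e-hom h)) (e-hom g)
  ; z-hom = z-∘ g h
  }
  where
  open Hom
  z-∘ : ∀ {b} {A B C : Alg b} (g : Hom B C) (h : Hom A B) →
        map₀ b (λ x → to g (to h x)) (Alg.z A) ≡ Alg.z C
  z-∘ {false} g h = refl
  z-∘ {true}  g h = trans (cong (to g) (z-hom h)) (z-hom g)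

-- Injectivity of `g` pulls every homomorphism law for `f` back from `k`. With `k` the identity, a
-- pointwise right inverse of `g` becomes a homomorphism.
cancelₕ : ∀ {b} {A B C : Alg b} (g : Hom B C) → Injective g → (k : Hom A C)
          (f : Alg.Carrier A → Alg.Carrier B) → (∀ x → to g (f x) ≡ to k x) → Hom A B
cancelₕ {b} {A} {B} {C} g g-inj k f gf≡k = record
  { to    = f
  ; ⊔-hom = λ x y → g-inj (trans (gf≡k _) (trans (⊔-hom k x y)
              (sym (trans (⊔-hom g _ _) (cong₂ (Alg._⊔_ C) (gf≡k x) (gf≡k y))))))
  ; ⊓-hom = λ x y → g-inj (trans (gf≡k _) (trans (⊓-hom k x y)
              (sym (trans (⊓-hom g _ _) (cong₂ (Alg._⊓_ C) (gf≡k x) (gf≡k y))))))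
  ; ·-hom = λ x y → g-inj (trans (gf≡k _) (trans (·-hom k x y)
              (sym (trans (·-hom g _ _) (cong₂ (Alg._·_ C) (gf≡k x) (gf≡k y))))))
  ; ⇒-hom = λ x y → g-inj (trans (gf≡k _) (trans (⇒-hom k x y)
              (sym (trans (⇒-hom g _ _) (cong₂ (Alg._⇒_ C) (gf≡k x) (gf≡k y))))))
  ; e-hom = g-inj (trans (gf≡k _) (trans (e-hom k) (sym (e-hom g))))
  ; z-hom = z-cancel g g-inj k f gf≡k
  }
  where
  open Hom
  z-cancel : ∀ {b} {A B C : Alg b} (g : Hom B C) → Injective g → (k : Hom A C)
             (f : Alg.Carrier A → Alg.Carrier B) → (∀ x → to g (f x) ≡ to k x) →
             map₀ b f (Alg.z A) ≡ Alg.z B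
  z-cancel {false} g g-inj k f gf≡k = refl
  z-cancel {true}  g g-inj k f gf≡k = g-inj (trans (gf≡k _) (trans (z-hom k) (sym (z-hom g))))

eval-hom : ∀ {b} {A B : Alg b} (h : Hom A B) ρ t →
           to h (eval A ρ t) ≡ eval B (λ i → to h (ρ i)) t
eval-hom h ρ (var i)  = refl
eval-hom {B = B} h ρ (s ∨ₜ t) = trans (Hom.⊔-hom h _ _) (cong₂ (Alg._⊔_ B) (eval-hom h ρ s) (eval-hom h ρ t))
eval-hom {B = B} h ρ (s ∧ₜ t) = trans (Hom.⊓-hom h _ _) (cong₂ (Alg._⊓_ B) (eval-hom h ρ s) (eval-hom h ρ t))
eval-hom {B = B} h ρ (s ·ₜ t) = trans (Hom.·-hom h _ _) (cong₂ (Alg._·_ B) (eval-hom h ρ s) (eval-hom h ρ t))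
eval-hom {B = B} h ρ (s ⇒ₜ t) = trans (Hom.⇒-hom h _ _) (cong₂ (Alg._⇒_ B) (eval-hom h ρ s) (eval-hom h ρ t))
eval-hom h ρ oneₜ     = Hom.e-hom h
eval-hom h ρ zerₜ     = Hom.z-hom h

-- Lets lemmas on congruences cover plain equality: pointwise equal assignments are exchanged
-- through it, without function extensionality.
≡-Cong : ∀ {b} {A : Alg b} → Cong A
≡-Cong {A = A} = record
  { θ = _≡_ ; refl' = λ _ → refl ; sym' = sym ; trans' = trans
  ; ⊔-cong = cong₂ (Alg._⊔_ A) ; ⊓-cong = cong₂ (Alg._⊓_ A)
  ; ·-cong = cong₂ (Alg._·_ A) ; ⇒-cong = cong₂ (Alg._⇒_ A) }

eval-congruent : ∀ {b} {A : Alg b} (θ : Cong A) {ρ ρ′} → (∀ i → Cong.θ θ (ρ i) (ρ′ i)) →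
                 ∀ t → Cong.θ θ (eval A ρ t) (eval A ρ′ t)
eval-congruent θ r (var i)  = r i
eval-congruent θ r (s ∨ₜ t) = Cong.⊔-cong θ (eval-congruent θ r s) (eval-congruent θ r t)
eval-congruent θ r (s ∧ₜ t) = Cong.⊓-cong θ (eval-congruent θ r s) (eval-congruent θ r t)
eval-congruent θ r (s ·ₜ t) = Cong.·-cong θ (eval-congruent θ r s) (eval-congruent θ r t)
eval-congruent θ r (s ⇒ₜ t) = Cong.⇒-cong θ (eval-congruent θ r s) (eval-congruent θ r t)
eval-congruent θ r oneₜ     = Cong.refl' θ _
eval-congruent θ r zerₜ     = Cong.refl' θ _

varBound : ∀ {b} → Term b → ℕ
varBound (var i)  = suc i
varBound (s ∨ₜ t) = varBound s ℕ.⊔ varBound t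
varBound (s ∧ₜ t) = varBound s ℕ.⊔ varBound t
varBound (s ·ₜ t) = varBound s ℕ.⊔ varBound t
varBound (s ⇒ₜ t) = varBound s ℕ.⊔ varBound t
varBound oneₜ     = 0
varBound zerₜ     = 0

eval-agree : ∀ {b} (A : Alg b) {ρ ρ′} (t : Term b) n → varBound t ℕ.≤ n →
             (∀ i → i ℕ.< n → ρ i ≡ ρ′ i) → eval A ρ t ≡ eval A ρ′ t
eval-agree A (var i)  n b≤n eq = eq i b≤n
eval-agree A (s ∨ₜ t) n b≤n eq = cong₂ (Alg._⊔_ A) (eval-agree A s n (ℕ.m⊔n≤o⇒m≤o _ _ b≤n) eq) (eval-agree A t n (ℕ.m⊔n≤o⇒n≤o _ _ b≤n) eq)
eval-agree A (s ∧ₜ t) n b≤n eq = cong₂ (Alg._⊓_ A) (eval-agree A s n (ℕ.m⊔n≤o⇒m≤o _ _ b≤n) eq) (eval-agree A t n (ℕ.m⊔n≤o⇒n≤o _ _ b≤n) eq)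
eval-agree A (s ·ₜ t) n b≤n eq = cong₂ (Alg._·_ A) (eval-agree A s n (ℕ.m⊔n≤o⇒m≤o _ _ b≤n) eq) (eval-agree A t n (ℕ.m⊔n≤o⇒n≤o _ _ b≤n) eq)
eval-agree A (s ⇒ₜ t) n b≤n eq = cong₂ (Alg._⇒_ A) (eval-agree A s n (ℕ.m⊔n≤o⇒m≤o _ _ b≤n) eq) (eval-agree A t n (ℕ.m⊔n≤o⇒n≤o _ _ b≤n) eq)
eval-agree A oneₜ     n b≤n eq = refl
eval-agree A zerₜ     n b≤n eq = refl

truncate : ∀ {b} (A : Alg b) → ℕ → (ℕ → Alg.Carrier A) → ℕ → Alg.Carrier A
truncate A n ρ i with i ℕ.<? n
... | yes _ = ρ i
-- The default 1 corresponds to the pair of dense elements (1 , 1), so in `Sat₀-dense⇒Sat` the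
-- variables beyond the bound need no splitting.
... | no  _ = Alg.e A

truncate-< : ∀ {b} (A : Alg b) n ρ {i} → i ℕ.< n → truncate A n ρ i ≡ ρ i
truncate-< A n ρ {i} i<n with i ℕ.<? n
... | yes _   = refl
... | no  i≮n = contradiction i<n i≮n

truncate-≥ : ∀ {b} (A : Alg b) n ρ {i} → n ℕ.≤ i → truncate A n ρ i ≡ Alg.e A
truncate-≥ A n ρ {i} n≤i with i ℕ.<? n
... | yes i<n = contradiction n≤i (ℕ.<⇒≱ i<n)
... | no  _   = refl

_[_↦_] : {X : Set} → (ℕ → X) → ℕ → X → ℕ → X
(ρ [ k ↦ y ]) i with i ℕ.≟ k
... | yes _ = y
... | no  _ = ρ i

module _ {X : Set} (ρ : ℕ → X) (k : ℕ) (y : X) where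

  update-elim : (Q : ℕ → X → Set) → Q k y → (∀ i → i ≢ k → Q i (ρ i)) → ∀ i → Q i ((ρ [ k ↦ y ]) i)
  update-elim Q qy qρ i with i ℕ.≟ k
  ... | yes refl = qy
  ... | no  i≢k  = qρ i i≢k

-- The algebra K₀ (2 ⊕ D) and its identities

-- In K (2 ⊕ D) the elements (a , b) other than (0 , 0) form the universe of K₀ (2 ⊕ D).
NonZero₂ : {X : Set} → Maybe X × Maybe X → Set
NonZero₂ (nothing , nothing) = ⊥
NonZero₂ (just _  , _      ) = ⊤
NonZero₂ (nothing , just _ ) = ⊤

NonZero₂-irrelevant : {X : Set} (p : Maybe X × Maybe X) (u v : NonZero₂ p) → u ≡ v
NonZero₂-irrelevant (just _  , _     ) tt tt = refl
NonZero₂-irrelevant (nothing , just _) tt tt = refl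

NonZero₂-map : {X Y : Set} (h : X → Y) (p : Maybe X × Maybe X) → NonZero₂ p →
               NonZero₂ (Prod.map (Maybe.map h) (Maybe.map h) p)
NonZero₂-map h (just _  , _     ) _ = tt
NonZero₂-map h (nothing , just _) _ = tt

module _ (D : Alg false) where
  private
    module KD = Alg (K (2⊕ D))

  NonZero₂-⊔ : ∀ p q → NonZero₂ p → NonZero₂ q → NonZero₂ (p KD.⊔ q)
  NonZero₂-⊔ (just _  , _     ) (just _  , _     ) _ _ = tt
  NonZero₂-⊔ (just _  , _     ) (nothing , _     ) _ _ = tt
  NonZero₂-⊔ (nothing , just _) (just _  , _     ) _ _ = tt
  NonZero₂-⊔ (nothing , just _) (nothing , just _) _ _ = tt

  NonZero₂-⊓ : ∀ p q → NonZero₂ p → NonZero₂ q → NonZero₂ (p KD.⊓ q)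
  NonZero₂-⊓ (just _  , _      ) (just _  , _      ) _ _ = tt
  NonZero₂-⊓ (just _  , nothing) (nothing , just _ ) _ _ = tt
  NonZero₂-⊓ (just _  , just _ ) (nothing , just _ ) _ _ = tt
  NonZero₂-⊓ (nothing , just _ ) (_ , nothing) _ _ = tt
  NonZero₂-⊓ (nothing , just _ ) (_ , just _ ) _ _ = tt

  NonZero₂-· : ∀ p q → NonZero₂ p → NonZero₂ q → NonZero₂ (p KD.· q)
  NonZero₂-· (just _  , _      ) (just _  , _      ) _ _ = tt
  NonZero₂-· (just _  , nothing) (nothing , just _ ) _ _ = tt
  NonZero₂-· (just _  , just _ ) (nothing , just _ ) _ _ = tt
  NonZero₂-· (nothing , just _ ) (nothing , just _ ) _ _ = tt
  NonZero₂-· (nothing , just _ ) (just _  , _      ) _ _ = tt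

  NonZero₂-⇒ : ∀ p q → NonZero₂ p → NonZero₂ q → NonZero₂ (p KD.⇒ q)
  NonZero₂-⇒ (just _  , nothing) (just _  , just _ ) _ _ = tt
  NonZero₂-⇒ (just _  , just _ ) (just _  , just _ ) _ _ = tt
  NonZero₂-⇒ (just _  , _      ) (nothing , just _ ) _ _ = tt
  NonZero₂-⇒ (just _  , _      ) (just _  , nothing) _ _ = tt
  NonZero₂-⇒ (nothing , just _ ) (_ , nothing) _ _ = tt
  NonZero₂-⇒ (nothing , just _ ) (_ , just _ ) _ _ = tt

Sat₀ : Alg false → Identity true → Set
Sat₀ D = SatSub (K (2⊕ D)) NonZero₂

-- `Mod` speaks of algebras, not of subuniverses; in this form `K₀ (2⊕ D)` can be a model of a set
-- of identities, as in `cover-down`.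
K₀-alg : Alg false → Alg true
K₀-alg D = record
  { Carrier = Σ (Maybe (Alg.Carrier D) × Maybe (Alg.Carrier D)) NonZero₂
  ; _⊔_ = λ (p , u) (q , v) → p KD.⊔ q , NonZero₂-⊔ D p q u v
  ; _⊓_ = λ (p , u) (q , v) → p KD.⊓ q , NonZero₂-⊓ D p q u v
  ; _·_ = λ (p , u) (q , v) → p KD.· q , NonZero₂-· D p q u v
  ; _⇒_ = λ (p , u) (q , v) → (p KD.⇒ q) , NonZero₂-⇒ D p q u v
  ; e = KD.e , tt
  ; z = KD.z , tt
  }
  where module KD = Alg (K (2⊕ D))

K₀-inclusion : ∀ D → Hom (K₀-alg D) (K (2⊕ D))
K₀-inclusion D = record
  { to = proj₁ ; ⊔-hom = λ _ _ → refl ; ⊓-hom = λ _ _ → refl ; ·-hom = λ _ _ → refl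
  ; ⇒-hom = λ _ _ → refl ; e-hom = refl ; z-hom = refl }

Sat₀⇒Sat : ∀ D ε → Sat₀ D ε → Sat (K₀-alg D) ε
Sat₀⇒Sat D (s , t) sat ρ = Σ-≡ (trans (eval-hom (K₀-inclusion D) ρ s)
    (trans (sat (λ i → proj₁ (ρ i)) (λ i → proj₂ (ρ i))) (sym (eval-hom (K₀-inclusion D) ρ t))))
  where
  Σ-≡ : ∀ {p q} → proj₁ p ≡ proj₁ q → p ≡ q
  Σ-≡ {p , u} {.p , v} refl = cong (p ,_) (NonZero₂-irrelevant p u v)

Sat⇒Sat₀ : ∀ D ε → Sat (K₀-alg D) ε → Sat₀ D ε
Sat⇒Sat₀ D (s , t) sat ρ nz = trans (sym (eval-hom (K₀-inclusion D) ρ₀ s))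
    (trans (cong proj₁ (sat ρ₀)) (eval-hom (K₀-inclusion D) ρ₀ t))
  where ρ₀ = λ i → ρ i , nz i

2⊕-hom : ∀ {D D′} → Hom D D′ → Hom (2⊕ D) (2⊕ D′)
2⊕-hom h = record
  { to    = Maybe.map (to h)
  ; ⊔-hom = λ { nothing _ → refl ; (just _) nothing → refl ; (just x) (just y) → cong just (⊔-hom h x y) }
  ; ⊓-hom = λ { nothing _ → refl ; (just _) nothing → refl ; (just x) (just y) → cong just (⊓-hom h x y) }
  ; ·-hom = λ { nothing _ → refl ; (just _) nothing → refl ; (just x) (just y) → cong just (·-hom h x y) }
  ; ⇒-hom = λ { nothing _ → cong just (e-hom h) ; (just _) nothing → refl ; (just x) (just y) → cong just (⇒-hom h x y) }
  ; e-hom = cong just (e-hom h)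
  ; z-hom = refl
  }
  where open Hom

K-hom : ∀ {B B′} → Hom B B′ → Hom (K B) (K B′)
K-hom {B′ = B′} h = record
  { to    = Prod.map (to h) (to h)
  ; ⊔-hom = λ _ _ → cong₂ _,_ (⊔-hom h _ _) (⊓-hom h _ _)
  ; ⊓-hom = λ _ _ → cong₂ _,_ (⊓-hom h _ _) (⊔-hom h _ _)
  ; ·-hom = λ _ _ → cong₂ _,_ (·-hom h _ _)
              (trans (⊓-hom h _ _) (cong₂ (Alg._⊓_ B′) (⇒-hom h _ _) (⇒-hom h _ _)))
  ; ⇒-hom = λ _ _ → cong₂ _,_
              (trans (⊓-hom h _ _) (cong₂ (Alg._⊓_ B′) (⇒-hom h _ _) (⇒-hom h _ _))) (·-hom h _ _)
  ; e-hom = cong₂ _,_ (e-hom h) (e-hom h)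
  ; z-hom = cong₂ _,_ (z-hom h) (e-hom h)
  }
  where open Hom

K-injective : ∀ {B B′} (h : Hom B B′) → Injective h → Injective (K-hom h)
K-injective h inj eq = cong₂ _,_ (inj (cong proj₁ eq)) (inj (cong proj₂ eq))

-- The absolutely free algebra. Evaluation in `K (2⊕ termAlg)` is symbolic: it decides which
-- coordinates vanish and leaves CIRL-terms in the others.
termAlg : Alg false
termAlg = record { Carrier = Term false ; _⊔_ = _∨ₜ_ ; _⊓_ = _∧ₜ_ ; _·_ = _·ₜ_ ; _⇒_ = _⇒ₜ_ ; e = oneₜ ; z = tt }

evalHom : ∀ D → (ℕ → Alg.Carrier D) → Hom termAlg D
evalHom D δ = record
  { to = eval D δ ; ⊔-hom = λ _ _ → refl ; ⊓-hom = λ _ _ → refl ; ·-hom = λ _ _ → refl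
  ; ⇒-hom = λ _ _ → refl ; e-hom = refl ; z-hom = refl }

Pattern : Set
Pattern = Maybe (Term false) × Maybe (Term false)

evalPattern : ∀ D → (ℕ → Alg.Carrier D) → Hom (K (2⊕ termAlg)) (K (2⊕ D))
evalPattern D δ = K-hom (2⊕-hom (evalHom D δ))

-- The identities of CIRL-type that ε yields on D when it is evaluated in K₀ (2 ⊕ D):
-- once it is known which coordinates of each variable are 0, both sides of ε are pairs whose
-- coordinates are either 0 or CIRL-terms.
record Component (ε : Identity true) (uv : Identity false) : Set where
  field
    σ       : ℕ → Pattern
    nonzero : ∀ i → NonZero₂ (σ i)
    values  : (∃ λ (π : Pattern → Maybe (Term false)) → (π ≡ proj₁ ⊎ π ≡ proj₂)
                 × π (eval (K (2⊕ termAlg)) σ (proj₁ ε)) ≡ just (proj₁ uv)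
                 × π (eval (K (2⊕ termAlg)) σ (proj₂ ε)) ≡ just (proj₂ uv))

-- The map `g` covers two uses: the identity for soundness in `K₀ (2⊕ D)`, and `to embed` in
-- `dense-mod`, where the two sides are only known to agree after they are sent into the negative
-- cone of another algebra.
component-value : ∀ {ε uv} (c : Component ε uv) D (δ : ℕ → Alg.Carrier D) {X : Set}
    (g : Maybe (Alg.Carrier D) → X) →
    Prod.map g g (eval (K (2⊕ D)) (λ i → to (evalPattern D δ) (Component.σ c i)) (proj₁ ε)) ≡
    Prod.map g g (eval (K (2⊕ D)) (λ i → to (evalPattern D δ) (Component.σ c i)) (proj₂ ε)) →
    g (just (eval D δ (proj₁ uv))) ≡ g (just (eval D δ (proj₂ uv)))
component-value {s , t} {u , v} c D δ g eq with Component.values c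
... | π , side , pu , pv = trans (cong (λ m → g (Maybe.map (eval D δ) m)) (sym pu))
        (trans (project side same) (cong (λ m → g (Maybe.map (eval D δ) m)) pv))
  where
  h = evalPattern D δ
  S = eval (K (2⊕ termAlg)) (Component.σ c) s
  T = eval (K (2⊕ termAlg)) (Component.σ c) t
  same : Prod.map g g (to h S) ≡ Prod.map g g (to h T)
  same = trans (cong (Prod.map g g) (eval-hom h (Component.σ c) s))
           (trans eq (sym (cong (Prod.map g g) (eval-hom h (Component.σ c) t))))
  project : π ≡ proj₁ ⊎ π ≡ proj₂ → Prod.map g g (to h S) ≡ Prod.map g g (to h T) →
            g (Maybe.map (eval D δ) (π S)) ≡ g (Maybe.map (eval D δ) (π T))
  project (inj₁ refl) q = cong proj₁ q
  project (inj₂ refl) q = cong proj₂ q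

component-sound : ∀ D {ε uv} → Sat₀ D ε → Component ε uv → Sat D uv
component-sound D {ε} {uv} sat c δ = just-injective (component-value c D δ (λ x → x)
  (sat _ (λ i → NonZero₂-map (eval D δ) (Component.σ c i) (Component.nonzero c i))))

-- A variable of ε has two coordinates in `K`, so variable i becomes the CIRL-variables 2i and 2i +
-- 1.
interleave : {X : Set} → (ℕ → X) → (ℕ → X) → ℕ → X
interleave f g zero          = f 0
interleave f g (suc zero)    = g 0
interleave f g (suc (suc n)) = interleave (λ i → f (suc i)) (λ i → g (suc i)) n

double : ℕ → ℕ
double zero    = zero
double (suc n) = suc (suc (double n))

interleave-even : {X : Set} (f g : ℕ → X) → ∀ n → interleave f g (double n) ≡ f n
interleave-even f g zero    = refl
interleave-even f g (suc n) = interleave-even (λ i → f (suc i)) (λ i → g (suc i)) n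

interleave-odd : {X : Set} (f g : ℕ → X) → ∀ n → interleave f g (suc (double n)) ≡ g n
interleave-odd f g zero    = refl
interleave-odd f g (suc n) = interleave-odd (λ i → f (suc i)) (λ i → g (suc i)) n

-- D only serves to know that the two sides of ε vanish in the same coordinates.
Sat₀-transfer : ∀ D E {ε} → Sat₀ D ε → (∀ uv → Component ε uv → Sat E uv) → Sat₀ E ε
Sat₀-transfer D E {s , t} satD satE ρ nz =
  trans (eval-pattern s) (trans (cong₂ _,_ left right) (sym (eval-pattern t)))
  where
  F = K (2⊕ termAlg)
  X = Alg.Carrier E
  a b : ℕ → X
  -- The default at a zero coordinate is never read: `mark` leaves the corresponding variable out of
  -- `σ`.
  a i = Maybe.fromMaybe (Alg.e E) (proj₁ (ρ i))
  b i = Maybe.fromMaybe (Alg.e E) (proj₂ (ρ i))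
  δ : ℕ → X
  δ = interleave a b
  mark : ℕ → Maybe X → Maybe (Term false)
  mark k = Maybe.map (λ _ → var k)
  σ : ℕ → Pattern
  σ i = mark (double i) (proj₁ (ρ i)) , mark (suc (double i)) (proj₂ (ρ i))
  mark-value : ∀ k (m : Maybe X) → δ k ≡ Maybe.fromMaybe (Alg.e E) m → m ≡ Maybe.map (eval E δ) (mark k m)
  mark-value k (just _) eq = cong just (sym eq)
  mark-value k nothing  eq = refl
  mark-nonzero : ∀ k l p → NonZero₂ p → NonZero₂ (mark k (proj₁ p) , mark l (proj₂ p))
  mark-nonzero k l (just _  , _     ) _ = tt
  mark-nonzero k l (nothing , just _) _ = tt
  σ-nonzero : ∀ i → NonZero₂ (σ i)
  σ-nonzero i = mark-nonzero _ _ (ρ i) (nz i)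
  σ-value : ∀ i → ρ i ≡ to (evalPattern E δ) (σ i)
  σ-value i = cong₂ _,_ (mark-value _ (proj₁ (ρ i)) (interleave-even a b i))
                        (mark-value _ (proj₂ (ρ i)) (interleave-odd a b i))
  eval-pattern : ∀ r → eval (K (2⊕ E)) ρ r ≡ to (evalPattern E δ) (eval F σ r)
  eval-pattern r = trans (eval-congruent ≡-Cong σ-value r) (sym (eval-hom (evalPattern E δ) σ r))
  S = eval F σ s
  T = eval F σ t
  -- Any assignment serves: which coordinates are `nothing` depends on `σ` alone.
  δ₁ : ℕ → Alg.Carrier D
  δ₁ _ = Alg.e D
  sameD : to (evalPattern D δ₁) S ≡ to (evalPattern D δ₁) T
  sameD = trans (eval-hom (evalPattern D δ₁) σ s)
    (trans (satD _ (λ i → NonZero₂-map (eval D δ₁) (σ i) (σ-nonzero i)))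
           (sym (eval-hom (evalPattern D δ₁) σ t)))
  match : ∀ (p q : Maybe (Term false)) → Maybe.map (eval D δ₁) p ≡ Maybe.map (eval D δ₁) q →
          (∀ u v → p ≡ just u → q ≡ just v → Sat E (u , v)) →
          Maybe.map (eval E δ) p ≡ Maybe.map (eval E δ) q
  match nothing  nothing  eq sat = refl
  match (just u) (just v) eq sat = cong just (sat u v refl refl δ)
  left : Maybe.map (eval E δ) (proj₁ S) ≡ Maybe.map (eval E δ) (proj₁ T)
  left = match (proj₁ S) (proj₁ T) (cong proj₁ sameD) λ u v pu pv → satE (u , v)
    record { σ = σ ; nonzero = σ-nonzero ; values = proj₁ , inj₁ refl , pu , pv }
  right : Maybe.map (eval E δ) (proj₂ S) ≡ Maybe.map (eval E δ) (proj₂ T)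
  right = match (proj₂ S) (proj₂ T) (cong proj₂ sameD) λ u v pu pv → satE (u , v)
    record { σ = σ ; nonzero = σ-nonzero ; values = proj₂ , inj₂ refl , pu , pv }

Sat₀-mono : ∀ D E → (∀ ε → Sat D ε → Sat E ε) → ∀ ε → Sat₀ D ε → Sat₀ E ε
Sat₀-mono D E D⊆E ε sat = Sat₀-transfer D E {ε} sat (λ uv c → D⊆E uv (component-sound D {ε} {uv} sat c))

-- Relativising identities to dense elements

-- The consequences of `IsCIRL` that calculations in `K (2⊕ D)` rely on. They are identities, so
-- they pass to every member of V(D).
record Integral (D : Alg false) : Set where
  open Alg D
  field
    ⊔-e : ∀ x → x ⊔ e ≡ e
    ⊓-e : ∀ x → x ⊓ e ≡ x
    ·-e : ∀ x → x · e ≡ x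
    ⇒-e : ∀ x → (x ⇒ e) ≡ e

Integral-transfer : ∀ {D E} → (∀ ε → Sat D ε → Sat E ε) → Integral D → Integral E
Integral-transfer D⊆E int = record
  { ⊔-e = λ x → D⊆E (var 0 ∨ₜ oneₜ , oneₜ)  (λ _ → ⊔-e _) (λ _ → x)
  ; ⊓-e = λ x → D⊆E (var 0 ∧ₜ oneₜ , var 0) (λ _ → ⊓-e _) (λ _ → x)
  ; ·-e = λ x → D⊆E (var 0 ·ₜ oneₜ , var 0) (λ _ → ·-e _) (λ _ → x)
  ; ⇒-e = λ x → D⊆E (var 0 ⇒ₜ oneₜ , oneₜ)  (λ _ → ⇒-e _) (λ _ → x) }
  where open Integral int

-- For a ≤ 1 in a Stone negative cone, a ∨ ¬ a is dense, and it equals a when a is dense already. So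
-- `denseₜ` is a term-definable retraction onto the dense elements.
negₜ denseₜ : Term true → Term true
negₜ t   = (t ⇒ₜ zerₜ) ∧ₜ oneₜ
denseₜ t = (t ∧ₜ oneₜ) ∨ₜ negₜ (t ∧ₜ oneₜ)

module _ (C : Alg true) where
  open Alg C

  neg : Carrier → Carrier
  neg = ¬⁻_ C

  densify : Carrier → Carrier
  densify x = (x ⊓ e) ⊔ neg (x ⊓ e)

star : Term false → Term true
star (var i)  = denseₜ (var i)
star (s ∨ₜ t) = star s ∨ₜ star t
star (s ∧ₜ t) = star s ∧ₜ star t
star (s ·ₜ t) = star s ·ₜ star t
star (s ⇒ₜ t) = (star s ⇒ₜ star t) ∧ₜ oneₜ
star oneₜ     = oneₜ

star² : Identity false → Identity true
star² (s , t) = star s , star t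

-- Common form of two situations: `D` inside `K (2⊕ D)` as the pairs (x , 1), and the dense elements
-- inside an arbitrary member of K(SRL).
record DensePart (D : Alg false) (C : Alg true) : Set where
  private
    module D = Alg D
  open Alg C
  field
    g         : D.Carrier → Carrier
    g-inj     : ∀ {x y} → g x ≡ g y → x ≡ y
    g-⊔       : ∀ x y → g (x D.⊔ y) ≡ g x ⊔ g y
    g-⊓       : ∀ x y → g (x D.⊓ y) ≡ g x ⊓ g y
    g-·       : ∀ x y → g (x D.· y) ≡ g x · g y
    g-⇒       : ∀ x y → g (x D.⇒ y) ≡ (g x ⇒ g y) ⊓ e
    g-e       : g D.e ≡ e
    densify-g : ∀ x → densify C (g x) ≡ g x
    densified : ∀ x → ∃ λ d → densify C x ≡ g d

  eval-star : ∀ {ρ δ} → (∀ i → densify C (ρ i) ≡ g (δ i)) → ∀ t → eval C ρ (star t) ≡ g (eval D δ t)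
  eval-star ρ≡δ (var i)  = ρ≡δ i
  eval-star ρ≡δ (s ∨ₜ t) = trans (cong₂ _⊔_ (eval-star ρ≡δ s) (eval-star ρ≡δ t)) (sym (g-⊔ _ _))
  eval-star ρ≡δ (s ∧ₜ t) = trans (cong₂ _⊓_ (eval-star ρ≡δ s) (eval-star ρ≡δ t)) (sym (g-⊓ _ _))
  eval-star ρ≡δ (s ·ₜ t) = trans (cong₂ _·_ (eval-star ρ≡δ s) (eval-star ρ≡δ t)) (sym (g-· _ _))
  eval-star ρ≡δ (s ⇒ₜ t) = trans (cong (_⊓ e) (cong₂ _⇒_ (eval-star ρ≡δ s) (eval-star ρ≡δ t))) (sym (g-⇒ _ _))
  eval-star ρ≡δ oneₜ     = sym g-e

  star-sound : ∀ ε → Sat D ε → Sat C (star² ε)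
  star-sound (s , t) sat ρ = trans (eval-star ρ≡δ s) (trans (cong g (sat _)) (sym (eval-star ρ≡δ t)))
    where ρ≡δ = λ i → proj₂ (densified (ρ i))

  star-complete : {P : Carrier → Set} → (∀ x → P (g x)) → ∀ ε → SatSub C P (star² ε) → Sat D ε
  star-complete Pg (s , t) sat δ = g-inj (trans (sym (eval-star densify-δ s))
      (trans (sat (λ i → g (δ i)) (λ i → Pg (δ i))) (eval-star densify-δ t)))
    where densify-δ = λ i → densify-g (δ i)

module _ {D : Alg false} (int : Integral D) where
  open Alg D
  open Integral int

  densePart : DensePart D (K (2⊕ D))
  densePart = record
    { g         = g
    ; g-inj     = λ eq → just-injective (cong proj₁ eq)
    ; g-⊔       = λ x y → cong₂ _,_ refl (cong just (sym (⊓-e e)))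
    ; g-⊓       = λ x y → cong₂ _,_ refl (cong just (sym (⊔-e e)))
    ; g-·       = λ x y → cong₂ _,_ refl (cong just (sym (trans (cong₂ _⊓_ (⇒-e x) (⇒-e y)) (⊓-e e))))
    ; g-⇒       = λ x y → cong₂ _,_
                    (cong just (sym (trans (⊓-e _) (trans (cong ((x ⇒ y) ⊓_) (⇒-e e)) (⊓-e _)))))
                    (cong just (sym (⊔-e _)))
    ; g-e       = refl
    ; densify-g = λ x → cong₂ _,_ (cong just (⊓-e x))
                    (cong just (trans (cong₂ _⊓_ (⊔-e e) (⊔-e _)) (⊓-e e)))
    ; densified = densified
    }
    where
    g : Carrier → Maybe Carrier × Maybe Carrier
    g x = just x , just e
    densified : ∀ x → ∃ λ d → densify (K (2⊕ D)) x ≡ g d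
    densified (nothing , nothing) = _ , cong₂ _,_ refl (cong just (⊓-e e))
    densified (nothing , just b)  = _ , cong₂ _,_ refl (cong just (trans (⊓-e _) (⊔-e b)))
    densified (just a , nothing)  = _ , cong₂ _,_ refl (cong just (trans (cong (e ⊓_) (⊔-e _)) (⊓-e e)))
    densified (just a , just b)   = _ , cong₂ _,_ refl (cong just (trans (cong₂ _⊓_ (⊔-e b) (⊔-e _)) (⊓-e e)))

  Sat⇒Sat₀-star : ∀ ε → Sat D ε → Sat₀ D (star² ε)
  Sat⇒Sat₀-star ε sat ρ _ = DensePart.star-sound densePart ε sat ρ

  Sat₀-star⇒Sat : ∀ ε → Sat₀ D (star² ε) → Sat D ε
  Sat₀-star⇒Sat ε sat = DensePart.star-complete densePart {NonZero₂} (λ _ → tt) ε sat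

  K₀⊆NonZero₂ : ∀ {p} → K₀ (2⊕ D) p → NonZero₂ p
  K₀⊆NonZero₂ (gen {p} p≤e) = negative p p≤e
    where
    negative : ∀ p → _≤_ (K (2⊕ D)) p (Alg.e (K (2⊕ D))) → NonZero₂ p
    negative (just _  , _      ) _ = tt
    negative (nothing , just _ ) _ = tt
    negative (nothing , nothing) ()
  K₀⊆NonZero₂ (s⊔ {p} {q} u v) = NonZero₂-⊔ D p q (K₀⊆NonZero₂ u) (K₀⊆NonZero₂ v)
  K₀⊆NonZero₂ (s⊓ {p} {q} u v) = NonZero₂-⊓ D p q (K₀⊆NonZero₂ u) (K₀⊆NonZero₂ v)
  K₀⊆NonZero₂ (s· {p} {q} u v) = NonZero₂-· D p q (K₀⊆NonZero₂ u) (K₀⊆NonZero₂ v)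
  K₀⊆NonZero₂ (s⇒ {p} {q} u v) = NonZero₂-⇒ D p q (K₀⊆NonZero₂ u) (K₀⊆NonZero₂ v)
  K₀⊆NonZero₂ sone = tt
  K₀⊆NonZero₂ szer = tt

  -- The pairs (d , 1) lie in the negative cone and ∼ swaps coordinates. Then (d , 0) = (d , 1) · (1
  -- , 0) with (1 , 0) = ∼ 0, and (a , b) = (a , 0) ∧ (1 , b).
  NonZero₂⊆K₀ : ∀ p → NonZero₂ p → K₀ (2⊕ D) p
  NonZero₂⊆K₀ = generated
    where
    module KD = Alg (K (2⊕ D))
    K₀D = K₀ (2⊕ D)
    cone : ∀ d → K₀D (just d , KD.e .proj₂)
    cone d = gen (cong₂ _,_ (cong just (⊓-e d)) (cong just (⊔-e e)))
    swap : ∀ {a b} → ((a , b) KD.⇒ KD.e) ≡ (b , a) → K₀D (a , b) → K₀D (b , a)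
    swap eq u = subst K₀D eq (s⇒ u sone)
    swap-cone : ∀ d → K₀D (just e , just d)
    swap-cone d = swap (cong₂ _,_ (cong just (trans (cong₂ _⊓_ (⇒-e d) (⇒-e e)) (⊓-e e)))
                                  (cong just (·-e d))) (cone d)
    right-zero : ∀ d → K₀D (just d , nothing)
    right-zero d = subst K₀D (cong₂ _,_ (cong just (·-e d)) refl)
      (s· (cone d) (swap (cong₂ _,_ (cong just (trans (cong (e ⊓_) (⇒-e e)) (⊓-e e))) refl) szer))
    generated : ∀ p → NonZero₂ p → K₀D p
    generated (just a  , nothing) _ = right-zero a
    generated (nothing , just b ) _ = swap (cong₂ _,_ refl (cong just (·-e b))) (right-zero b)
    generated (just a  , just b ) _ =
      subst K₀D (cong₂ _,_ (cong just (⊓-e a)) refl) (s⊓ (right-zero a) (swap-cone b))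

  Sat₀⇒SatK₀ : ∀ ε → Sat₀ D ε → SatSub (K (2⊕ D)) (K₀ (2⊕ D)) ε
  Sat₀⇒SatK₀ ε sat ρ ρ∈K₀ = sat ρ (λ i → K₀⊆NonZero₂ (ρ∈K₀ i))

  SatK₀⇒Sat₀ : ∀ ε → SatSub (K (2⊕ D)) (K₀ (2⊕ D)) ε → Sat₀ D ε
  SatK₀⇒Sat₀ ε sat ρ nz = sat ρ (λ i → NonZero₂⊆K₀ (ρ i) (nz i))

  module _ {A : Alg true} (iso : IsoToSub A (K (2⊕ D)) (K₀ (2⊕ D))) where
    open IsoToSub iso

    isoHom : Hom A (K (2⊕ D))
    isoHom = record
      { to = f ; ⊔-hom = f-⊔ ; ⊓-hom = f-⊓ ; ·-hom = f-· ; ⇒-hom = f-⇒ ; e-hom = f-e ; z-hom = f-z }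

    Sat₀⇒SatIso : ∀ ε → Sat₀ D ε → Sat A ε
    Sat₀⇒SatIso (s , t) sat ρ = inj _ _ (trans (eval-hom isoHom ρ s)
      (trans (sat _ (λ i → K₀⊆NonZero₂ (into (ρ i)))) (sym (eval-hom isoHom ρ t))))

    SatIso⇒Sat₀ : ∀ ε → Sat A ε → Sat₀ D ε
    SatIso⇒Sat₀ (s , t) sat ρ nz = trans (lift s) (trans (cong f (sat ρ′)) (sym (lift t)))
      where
      preimage = λ i → onto (ρ i) (NonZero₂⊆K₀ (ρ i) (nz i))
      ρ′ = λ i → proj₁ (preimage i)
      lift : ∀ r → eval (K (2⊕ D)) ρ r ≡ f (eval A ρ′ r)
      lift r = trans (eval-congruent ≡-Cong (λ i → sym (proj₂ (preimage i))) r) (sym (eval-hom isoHom ρ′ r))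

-- Residuated lattices

module CRL {b} (A : Alg b) (isCRL : IsCommResLattice A) where
  open Alg A
  open IsCommResLattice isCRL

  infix 4 _≼_
  _≼_ : Carrier → Carrier → Set
  _≼_ = _≤_ A

  ≼-refl : ∀ {x} → x ≼ x
  ≼-refl {x} = trans (cong (x ⊓_) (sym (⊔-absorbs-⊓ x x))) (⊓-absorbs-⊔ x (x ⊓ x))

  ≼-reflexive : ∀ {x y} → x ≡ y → x ≼ y
  ≼-reflexive refl = ≼-refl

  ≼-trans : ∀ {x y w} → x ≼ y → y ≼ w → x ≼ w
  ≼-trans {x} {y} {w} p q =
    trans (cong (_⊓ w) (sym p)) (trans (⊓-assoc x y w) (trans (cong (x ⊓_) q) p))

  ≼-respˡ : ∀ {x y w} → x ≡ y → x ≼ w → y ≼ w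
  ≼-respˡ refl p = p

  ≼-respʳ : ∀ {x y w} → x ≡ y → w ≼ x → w ≼ y
  ≼-respʳ refl p = p

  ≼-antisym : ∀ {x y} → x ≼ y → y ≼ x → x ≡ y
  ≼-antisym p q = trans (sym p) (trans (⊓-comm _ _) q)

  x⊓y≼x : ∀ {x y} → x ⊓ y ≼ x
  x⊓y≼x {x} {y} = trans (⊓-comm _ _) (trans (sym (⊓-assoc x x y)) (cong (_⊓ y) ≼-refl))

  x⊓y≼y : ∀ {x y} → x ⊓ y ≼ y
  x⊓y≼y {x} {y} = trans (⊓-assoc x y y) (cong (x ⊓_) ≼-refl)

  ⊓-glb : ∀ {x y w} → w ≼ x → w ≼ y → w ≼ x ⊓ y
  ⊓-glb {x} {y} {w} p q = trans (sym (⊓-assoc w x y)) (trans (cong (_⊓ y) p) q)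

  ⊓-mono : ∀ {x y x′ y′} → x ≼ x′ → y ≼ y′ → x ⊓ y ≼ x′ ⊓ y′
  ⊓-mono p q = ⊓-glb (≼-trans x⊓y≼x p) (≼-trans x⊓y≼y q)

  x≼x⊔y : ∀ {x y} → x ≼ x ⊔ y
  x≼x⊔y = ⊓-absorbs-⊔ _ _

  y≼x⊔y : ∀ {x y} → y ≼ x ⊔ y
  y≼x⊔y {x} {y} = trans (cong (y ⊓_) (⊔-comm x y)) (⊓-absorbs-⊔ y x)

  ≼⇒⊔≡ : ∀ {x y} → x ≼ y → x ⊔ y ≡ y
  ≼⇒⊔≡ {x} {y} p = trans (⊔-comm x y) (trans (cong (y ⊔_) (trans (sym p) (⊓-comm x y))) (⊔-absorbs-⊓ y x))

  ⊔≡⇒≼ : ∀ {x y} → x ⊔ y ≡ y → x ≼ y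
  ⊔≡⇒≼ {x} {y} p = subst (x ≼_) p x≼x⊔y

  ⊔-lub : ∀ {x y w} → x ≼ w → y ≼ w → x ⊔ y ≼ w
  ⊔-lub {x} {y} {w} p q = ⊔≡⇒≼ (trans (⊔-assoc x y w) (trans (cong (x ⊔_) (≼⇒⊔≡ q)) (≼⇒⊔≡ p)))

  curry : ∀ {x y w} → x · y ≼ w → x ≼ (y ⇒ w)
  curry = residuation₁ _ _ _

  uncurry : ∀ {x y w} → x ≼ (y ⇒ w) → x · y ≼ w
  uncurry = residuation₂ _ _ _

  modusPonens : ∀ {x y} → (x ⇒ y) · x ≼ y
  modusPonens = uncurry ≼-refl

  ·-monoˡ : ∀ {x y w} → x ≼ y → x · w ≼ y · w
  ·-monoˡ p = uncurry (≼-trans p (curry ≼-refl))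

  ·-monoʳ : ∀ {x y w} → x ≼ y → w · x ≼ w · y
  ·-monoʳ {x} {y} {w} p = subst₂ _≼_ (·-comm x w) (·-comm y w) (·-monoˡ p)

  ⇒-mono : ∀ {x y x′ y′} → x′ ≼ x → y ≼ y′ → (x ⇒ y) ≼ (x′ ⇒ y′)
  ⇒-mono p q = curry (≼-trans (·-monoʳ p) (≼-trans modusPonens q))

  ·-identityʳ : ∀ x → x · e ≡ x
  ·-identityʳ x = trans (·-comm x e) (·-identity x)

  ·-≼ˡ : ∀ {x y} → y ≼ e → x · y ≼ x
  ·-≼ˡ {x} p = ≼-respʳ (·-identityʳ x) (·-monoʳ p)

  ·-≼ʳ : ∀ {x y} → x ≼ e → x · y ≼ y
  ·-≼ʳ {x} {y} p = ≼-respˡ (·-comm y x) (·-≼ˡ p)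

  ·-distribˡ-⊔ : ∀ x y w → x · (y ⊔ w) ≡ x · y ⊔ x · w
  ·-distribˡ-⊔ x y w = ≼-antisym
    (≼-respˡ (·-comm _ _) (uncurry (⊔-lub (curry (≼-trans (≼-reflexive (·-comm y x)) x≼x⊔y))
                                               (curry (≼-trans (≼-reflexive (·-comm w x)) y≼x⊔y)))))
    (⊔-lub (·-monoʳ x≼x⊔y) (·-monoʳ y≼x⊔y))

  ·-distribʳ-⊔ : ∀ x y w → (y ⊔ w) · x ≡ y · x ⊔ w · x
  ·-distribʳ-⊔ x y w = trans (·-comm _ x) (trans (·-distribˡ-⊔ x y w) (cong₂ _⊔_ (·-comm x y) (·-comm x w)))

  e⇒x : ∀ x → (e ⇒ x) ≡ x
  e⇒x x = ≼-antisym (≼-respˡ (·-identityʳ _) modusPonens) (curry (≼-reflexive (·-identityʳ x)))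

  ·⇒-curry : ∀ x y w → (x · y ⇒ w) ≡ (x ⇒ (y ⇒ w))
  ·⇒-curry x y w = ≼-antisym
    (curry (curry (≼-respˡ (sym (·-assoc _ x y)) modusPonens)))
    (curry (≼-respˡ (·-assoc _ x y) (uncurry modusPonens)))

  ⇒-distribˡ-⊓ : ∀ x y w → (x ⇒ y ⊓ w) ≡ (x ⇒ y) ⊓ (x ⇒ w)
  ⇒-distribˡ-⊓ x y w = ≼-antisym
    (⊓-glb (⇒-mono ≼-refl x⊓y≼x) (⇒-mono ≼-refl x⊓y≼y))
    (curry (⊓-glb (uncurry x⊓y≼x) (uncurry x⊓y≼y)))

  ⊔⇒-distrib : ∀ x y w → (x ⊔ y ⇒ w) ≡ (x ⇒ w) ⊓ (y ⇒ w)
  ⊔⇒-distrib x y w = ≼-antisym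
    (⊓-glb (⇒-mono x≼x⊔y ≼-refl) (⇒-mono y≼x⊔y ≼-refl))
    (curry (≼-respˡ (sym (·-distribˡ-⊔ _ x y)) (⊔-lub (uncurry x⊓y≼x) (uncurry x⊓y≼y))))

  ⊓-⊓-e : ∀ x y → (x ⊓ y) ⊓ e ≡ (x ⊓ e) ⊓ (y ⊓ e)
  ⊓-⊓-e x y = ≼-antisym
    (⊓-glb (⊓-mono x⊓y≼x ≼-refl) (⊓-mono x⊓y≼y ≼-refl))
    (⊓-glb (⊓-mono x⊓y≼x x⊓y≼x) (≼-trans x⊓y≼x x⊓y≼y))

  e≼⇒ : ∀ {x y} → x ≼ y → e ≼ (x ⇒ y)
  e≼⇒ {x} p = curry (≼-trans (≼-reflexive (·-identity x)) p)

  record IsIdempotent (u : Carrier) : Set where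
    field
      u≼e : u ≼ e
      u·u : u · u ≡ u

  e-idempotent : IsIdempotent e
  e-idempotent = record { u≼e = ≼-refl ; u·u = ·-identity e }

  ·-·-swap : ∀ u v x y → (u · v) · (x · y) ≡ (u · x) · (v · y)
  ·-·-swap u v x y = trans (·-assoc u v _) (trans (cong (u ·_) (trans (sym (·-assoc v x y))
    (trans (cong (_· y) (·-comm v x)) (·-assoc x v y)))) (sym (·-assoc u x _)))

  ·-idempotent : ∀ {u v} → IsIdempotent u → IsIdempotent v → IsIdempotent (u · v)
  ·-idempotent p q = record
    { u≼e = ≼-trans (·-≼ʳ (u≼e p)) (u≼e q)
    ; u·u = trans (·-·-swap _ _ _ _) (cong₂ _·_ (u·u p) (u·u q)) }
    where open IsIdempotent

  -- For an idempotent u ≤ 1, the congruence of the filter generated by u.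
  filterCong : ∀ {u} → IsIdempotent u → Cong A
  filterCong {u} idem = record
    { θ      = λ x y → u · x ≡ u · y
    ; refl'  = λ _ → refl
    ; sym'   = sym
    ; trans' = trans
    ; ⊔-cong = λ p q → trans (·-distribˡ-⊔ u _ _) (trans (cong₂ _⊔_ p q) (sym (·-distribˡ-⊔ u _ _)))
    ; ⊓-cong = λ p q → trans (reduce-⊓ _ _) (trans (cong (u ·_) (cong₂ _⊓_ p q)) (sym (reduce-⊓ _ _)))
    ; ·-cong = λ p q → trans (reduce-· _ _) (trans (cong₂ _·_ p q) (sym (reduce-· _ _)))
    ; ⇒-cong = λ p q → trans (reduce-⇒ _ _) (trans (cong (u ·_) (cong₂ _⇒_ p q)) (sym (reduce-⇒ _ _)))
    }
    where
    open IsIdempotent idem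
    absorb : ∀ x → u · (u · x) ≡ u · x
    absorb x = trans (sym (·-assoc u u x)) (cong (_· x) u·u)
    reduce-· : ∀ x y → u · (x · y) ≡ (u · x) · (u · y)
    reduce-· x y = trans (cong (_· (x · y)) (sym u·u)) (·-·-swap u u x y)
    reduce-⊓ : ∀ x y → u · (x ⊓ y) ≡ u · ((u · x) ⊓ (u · y))
    reduce-⊓ x y = ≼-antisym
      (≼-respˡ (absorb _) (·-monoʳ (⊓-glb (·-monoʳ x⊓y≼x) (·-monoʳ x⊓y≼y))))
      (·-monoʳ (⊓-mono (·-≼ʳ u≼e) (·-≼ʳ u≼e)))
    reduce-⇒ : ∀ x y → u · (x ⇒ y) ≡ u · (u · x ⇒ u · y)
    reduce-⇒ x y = ≼-antisym
      (≼-respˡ (absorb _) (·-monoʳ (curry (≼-respˡ (sym (·-assoc u _ _))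
        (·-monoʳ (≼-trans (·-monoʳ (·-≼ʳ u≼e)) modusPonens))))))
      (≼-respˡ (absorb _) (·-monoʳ (curry (≼-trans (≼-reflexive eq) (≼-trans modusPonens (·-≼ʳ u≼e))))))
      where
      eq : (u · (u · x ⇒ u · y)) · x ≡ (u · x ⇒ u · y) · (u · x)
      eq = trans (cong (_· x) (·-comm u _)) (·-assoc _ u x)

  -- Since u ∨ v = 1, c = c · u ∨ c · v: agreement modulo both factors gives agreement modulo c.
  split-· : ∀ {u v} c x y → u ⊔ v ≡ e → (c · u) · x ≡ (c · u) · y → (c · v) · x ≡ (c · v) · y → c · x ≡ c · y
  split-· {u} {v} c x y u⊔v≡e p q = trans (expand x) (trans (cong₂ _⊔_ p q) (sym (expand y)))
    where
    expand : ∀ x → c · x ≡ (c · u) · x ⊔ (c · v) · x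
    expand x = trans (cong (_· x) (trans (sym (·-identityʳ c)) (trans (cong (c ·_) (sym u⊔v≡e)) (·-distribˡ-⊔ c u v))))
                     (·-distribʳ-⊔ x _ _)

IsCIRL⇒Integral : ∀ {D} → IsCIRL D → Integral D
IsCIRL⇒Integral {D} (crl , x≼e) = record
  { ⊔-e = λ x → ≼⇒⊔≡ (x≼e x)
  ; ⊓-e = x≼e
  ; ·-e = ·-identityʳ
  ; ⇒-e = λ x → ≼-antisym (x≼e _) (e≼⇒ (x≼e x)) }
  where open CRL D crl

-- Bounded K-lattices

module KLattice (C : Alg true) (isK : IsBoundedKLattice C) where
  open Alg C
  open IsBoundedKLattice isK public
  open IsCommResLattice isCRL public
  open CRL C isCRL public

  z≼ : ∀ {x} → z ≼ x
  z≼ = bottom _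

  z·x : ∀ x → z · x ≡ z
  z·x x = ≼-antisym (uncurry z≼) z≼

  imp⁻ : Carrier → Carrier → Carrier
  imp⁻ x y = (x ⇒ y) ⊓ e

  pos ngt : Carrier → Carrier
  pos x = x ⊓ e
  ngt x = (x ⇒ e) ⊓ e

  imp⁻-e : ∀ {x} → x ≼ e → imp⁻ x e ≡ e
  imp⁻-e p = ≼-antisym x⊓y≼y (⊓-glb (e≼⇒ p) ≼-refl)

  imp⁻-pos : ∀ {x} y → x ≼ e → imp⁻ x (pos y) ≡ imp⁻ x y
  imp⁻-pos {x} y p = trans (cong (_⊓ e) (⇒-distribˡ-⊓ x y e))
    (trans (⊓-assoc _ _ e) (cong ((x ⇒ y) ⊓_) (imp⁻-e p)))

  pos-imp : ∀ x y → pos (x ⇒ y) ≡ imp⁻ (pos x) (pos y) ⊓ imp⁻ (ngt y) (ngt x)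
  pos-imp x y = trans (cong (_⊓ e) (sym (⇒-split x y))) (trans (⊓-⊓-e _ _)
    (sym (cong₂ _⊓_ (imp⁻-pos y x⊓y≼y) (imp⁻-pos (x ⇒ e) x⊓y≼y))))

  pos-⊔ : ∀ x y → pos (x ⊔ y) ≡ pos x ⊔ pos y
  pos-⊔ x y = trans (⊓-comm _ e) (trans (dist₁ᵃ x y) (cong₂ _⊔_ (⊓-comm e x) (⊓-comm e y)))

  ∼-⊔ : ∀ x y → (x ⊔ y ⇒ e) ≡ (x ⇒ e) ⊓ (y ⇒ e)
  ∼-⊔ x y = ⊔⇒-distrib x y e

  ∼-⊓ : ∀ x y → (x ⊓ y ⇒ e) ≡ (x ⇒ e) ⊔ (y ⇒ e)
  ∼-⊓ x y = trans (cong (_⇒ e) (sym (trans (∼-⊔ _ _) (cong₂ _⊓_ (∼∼ x) (∼∼ y))))) (∼∼ _)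

  ∼-⇒ : ∀ x y → ((x ⇒ y) ⇒ e) ≡ x · (y ⇒ e)
  ∼-⇒ x y = trans (cong (_⇒ e) (sym (trans (·⇒-curry x (y ⇒ e) e) (cong (x ⇒_) (∼∼ y))))) (∼∼ _)

  ngt-⊔ : ∀ x y → ngt (x ⊔ y) ≡ ngt x ⊓ ngt y
  ngt-⊔ x y = trans (cong (_⊓ e) (∼-⊔ x y)) (⊓-⊓-e _ _)

  ngt-⊓ : ∀ x y → ngt (x ⊓ y) ≡ ngt x ⊔ ngt y
  ngt-⊓ x y = trans (cong (_⊓ e) (∼-⊓ x y)) (pos-⊔ _ _)

  ngt-· : ∀ x y → ngt (x · y) ≡ imp⁻ (pos x) (ngt y) ⊓ imp⁻ (pos y) (ngt x)
  ngt-· x y = trans (cong (_⊓ e) (·⇒-curry x y e)) (trans (pos-imp x (y ⇒ e))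
    (cong (λ w → imp⁻ (pos x) (ngt y) ⊓ imp⁻ (w ⊓ e) (ngt x)) (∼∼ y)))

  ngt-⇒ : ∀ x y → ngt (x ⇒ y) ≡ pos x · ngt y
  ngt-⇒ x y = trans (cong (_⊓ e) (∼-⇒ x y)) (·-neg x (y ⇒ e))

  ngt-≼e : ∀ {x} → x ≼ e → ngt x ≡ e
  ngt-≼e = imp⁻-e

  -- Distributivity at 1 makes x ↦ (x ∧ 1 , x ∨ 1) injective, and x ∨ 1 = ∼ (∼ x ∧ 1).
  pos-ngt-congruent : (θ : Cong C) → ∀ {x y} → Cong.θ θ (pos x) (pos y) → Cong.θ θ (ngt x) (ngt y) → Cong.θ θ x y
  pos-ngt-congruent θ {x} {y} p q = trans' (meetJoin x y join)
      (trans' (⊔-cong (subst (θ′ _) (⊓-comm x y) (refl' _)) p) (sym' (meetJoin y x (sym' join))))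
    where
    open Cong θ renaming (θ to θ′)
    ∼ngt : ∀ x → (ngt x ⇒ e) ≡ x ⊔ e
    ∼ngt x = trans (∼-⊓ _ e) (cong₂ _⊔_ (∼∼ x) (e⇒x e))
    join : θ′ (x ⊔ e) (y ⊔ e)
    join = subst₂ θ′ (∼ngt x) (∼ngt y) (⇒-cong q (refl' e))
    meetJoin : ∀ x y → θ′ (x ⊔ e) (y ⊔ e) → θ′ x ((x ⊓ y) ⊔ (x ⊓ e))
    meetJoin x y j = subst₂ θ′ (⊓-absorbs-⊔ x e) (dist₁ᶜ x y) (⊓-cong (refl' x) j)

  pos-ngt-injective : ∀ {x y} → pos x ≡ pos y → ngt x ≡ ngt y → x ≡ y
  pos-ngt-injective = pos-ngt-congruent ≡-Cong

  Σ-≡ : {P : Carrier → Set} → (∀ {x} (p q : P x) → p ≡ q) → {x y : Σ Carrier P} → proj₁ x ≡ proj₁ y → x ≡ y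
  Σ-≡ irr {x , p} {.x , q} refl = cong (x ,_) (irr p q)

  negAlg : Alg true
  negAlg = record
    { Carrier = Σ Carrier (_≼ e)
    ; _⊔_ = λ (x , p) (y , q) → x ⊔ y , ⊔-lub p q
    ; _⊓_ = λ (x , p) (y , q) → x ⊓ y , ≼-trans x⊓y≼x p
    ; _·_ = λ (x , p) (y , q) → x · y , ≼-trans (·-≼ʳ p) q
    ; _⇒_ = λ (x , p) (y , q) → imp⁻ x y , x⊓y≼y
    ; e   = e , ≼-refl
    ; z   = z , z≼ }

  neg-≡ : {x y : Alg.Carrier negAlg} → proj₁ x ≡ proj₁ y → x ≡ y
  neg-≡ = Σ-≡ uip

  twist : Hom C (K negAlg)
  twist = record
    { to    = λ x → (pos x , x⊓y≼y) , (ngt x , x⊓y≼y)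
    ; ⊔-hom = λ x y → cong₂ _,_ (neg-≡ (pos-⊔ x y)) (neg-≡ (ngt-⊔ x y))
    ; ⊓-hom = λ x y → cong₂ _,_ (neg-≡ (⊓-⊓-e x y)) (neg-≡ (ngt-⊓ x y))
    ; ·-hom = λ x y → cong₂ _,_ (neg-≡ (·-neg x y)) (neg-≡ (ngt-· x y))
    ; ⇒-hom = λ x y → cong₂ _,_ (neg-≡ (pos-imp x y)) (neg-≡ (ngt-⇒ x y))
    ; e-hom = cong₂ _,_ (neg-≡ ≼-refl) (neg-≡ (ngt-≼e ≼-refl))
    ; z-hom = cong₂ _,_ (neg-≡ z≼) (neg-≡ (ngt-≼e z≼)) }

  twist-injective : Injective twist
  twist-injective eq = pos-ngt-injective (cong (λ p → proj₁ (proj₁ p)) eq) (cong (λ p → proj₁ (proj₂ p)) eq)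

  -- The identity is evaluated in `C` on preimages of the arguments under `twist`. This serves both
  -- the copy of `K₄` and the dense patterns.
  realized-Sat : ∀ {B} (h : Hom B negAlg) s t → Sat C (s , t) → (ρ : ℕ → Alg.Carrier (K B)) →
                 (∀ i → ∃ λ x → to twist x ≡ to (K-hom h) (ρ i)) →
                 to (K-hom h) (eval (K B) ρ s) ≡ to (K-hom h) (eval (K B) ρ t)
  realized-Sat {B} h s t sat ρ real = trans (lift s) (trans (cong (to twist) (sat ρ′)) (sym (lift t)))
    where
    ρ′ = λ i → proj₁ (real i)
    lift : ∀ r → to (K-hom h) (eval (K B) ρ r) ≡ to twist (eval C ρ′ r)
    lift r = trans (eval-hom (K-hom h) ρ r)
      (trans (eval-congruent ≡-Cong (λ i → sym (proj₂ (real i))) r) (sym (eval-hom twist ρ′ r)))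

-- Stone negative cones and their dense elements

module StoneKLattice (C : Alg true) (inKSRL : InKSRL C) where
  open Alg C
  open KLattice C (proj₁ inKSRL) public

  stone : ∀ {x} → x ≼ e → neg C x ⊔ neg C (neg C x) ≡ e
  stone = proj₂ inKSRL _

  ¬e≡z : neg C e ≡ z
  ¬e≡z = trans (cong (_⊓ e) (e⇒x z)) z≼

  ¬z≡e : neg C z ≡ e
  ¬z≡e = ≼-antisym x⊓y≼y (⊓-glb (e≼⇒ z≼) ≼-refl)

  ¬x·x : ∀ {x} → neg C x · x ≡ z
  ¬x·x = ≼-antisym (uncurry x⊓y≼x) z≼

  ≼¬ : ∀ {w x} → w ≼ e → w · x ≼ z → w ≼ neg C x
  ≼¬ p q = ⊓-glb (curry q) p

  ¬-anti : ∀ {x y} → x ≼ y → neg C y ≼ neg C x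
  ¬-anti p = ⊓-mono (⇒-mono p ≼-refl) ≼-refl

  -- u = u · (u ∨ v) = u · u ∨ u · v, where the last term is 0. This makes `filterCong` applicable
  -- to ¬ x and ¬¬ x.
  disjoint-idempotent : ∀ {u v} → u ⊔ v ≡ e → u · v ≡ z → IsIdempotent u
  disjoint-idempotent {u} {v} u⊔v≡e u·v≡z = record
    { u≼e = ≼-respʳ u⊔v≡e x≼x⊔y
    ; u·u = trans (sym (trans (cong (u · u ⊔_) u·v≡z) (trans (⊔-comm _ z) (≼⇒⊔≡ z≼))))
              (trans (sym (·-distribˡ-⊔ u u v)) (trans (cong (u ·_) u⊔v≡e) (·-identityʳ u))) }

  ¬-idempotent : ∀ {x} → x ≼ e → IsIdempotent (neg C x)
  ¬-idempotent p = disjoint-idempotent (stone p) (trans (·-comm _ _) ¬x·x)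

  ¬¬-idempotent : ∀ {x} → x ≼ e → IsIdempotent (neg C (neg C x))
  ¬¬-idempotent p = disjoint-idempotent (trans (⊔-comm _ _) (stone p)) ¬x·x

  Dense : Carrier → Set
  Dense x = x ≼ e × neg C x ≡ z

  Dense-irrelevant : ∀ {x} (p q : Dense x) → p ≡ q
  Dense-irrelevant (p , p′) (q , q′) = cong₂ _,_ (uip p q) (uip p′ q′)

  Dense-up : ∀ {x y} → Dense x → x ≼ y → y ≼ e → Dense y
  Dense-up (_ , ¬x≡z) x≼y y≼e = y≼e , ≼-antisym (≼-respʳ ¬x≡z (¬-anti x≼y)) z≼

  Dense-e : Dense e
  Dense-e = ≼-refl , ¬e≡z

  -- For w = ¬ (x · y), w · x ≤ ¬ y = 0, hence w ≤ ¬ x = 0.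
  Dense-· : ∀ {x y} → Dense x → Dense y → Dense (x · y)
  Dense-· {x} {y} (x≼e , ¬x≡z) (y≼e , ¬y≡z) = ≼-trans (·-≼ʳ x≼e) y≼e ,
    ≼-antisym (≼-respʳ ¬x≡z (≼¬ x⊓y≼y (≼-respʳ ¬y≡z (≼¬ (≼-trans (·-≼ʳ x⊓y≼y) x≼e)
      (≼-respˡ (sym (·-assoc _ x y)) (≼-reflexive ¬x·x)))))) z≼

  Dense-⊔ : ∀ {x y} → Dense x → Dense y → Dense (x ⊔ y)
  Dense-⊔ p q = Dense-up p x≼x⊔y (⊔-lub (proj₁ p) (proj₁ q))

  Dense-⊓ : ∀ {x y} → Dense x → Dense y → Dense (x ⊓ y)
  Dense-⊓ p q = Dense-up (Dense-· p q) (⊓-glb (·-≼ˡ (proj₁ q)) (·-≼ʳ (proj₁ p))) (≼-trans x⊓y≼x (proj₁ p))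

  Dense-imp⁻ : ∀ {x y} → Dense x → Dense y → Dense (imp⁻ x y)
  Dense-imp⁻ p q = Dense-up q (⊓-glb (curry (·-≼ˡ (proj₁ p))) (proj₁ q)) x⊓y≼y

  -- Let w = ¬ (x ∨ ¬ x). Then w · ¬ x = 0, and w ≤ ¬ x gives w · ¬¬ x = 0, so the Stone law yields
  -- w = 0.
  Dense-x⊔¬x : ∀ {x} → x ≼ e → Dense (x ⊔ neg C x)
  Dense-x⊔¬x {x} x≼e = ⊔-lub x≼e x⊓y≼y , ≼-antisym
    (≼-respˡ (trans (sym (·-distribˡ-⊔ w _ _)) (trans (cong (w ·_) (stone x≼e)) (·-identityʳ w)))
      (⊔-lub w·¬x≼z (≼-trans (·-monoˡ w≼¬x) (≼-respˡ (·-comm _ _) (≼-reflexive ¬x·x))))) z≼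
    where
    w = neg C (x ⊔ neg C x)
    w≼¬x : w ≼ neg C x
    w≼¬x = ¬-anti x≼x⊔y
    w·¬x≼z : w · neg C x ≼ z
    w·¬x≼z = ≼-trans (·-monoʳ y≼x⊔y) (≼-reflexive ¬x·x)

  denseAlg : Alg false
  denseAlg = record
    { Carrier = Σ Carrier Dense
    ; _⊔_ = λ (x , p) (y , q) → x ⊔ y , Dense-⊔ p q
    ; _⊓_ = λ (x , p) (y , q) → x ⊓ y , Dense-⊓ p q
    ; _·_ = λ (x , p) (y , q) → x · y , Dense-· p q
    ; _⇒_ = λ (x , p) (y , q) → imp⁻ x y , Dense-imp⁻ p q
    ; e   = e , Dense-e
    ; z   = tt }

  dense-≡ : {x y : Alg.Carrier denseAlg} → proj₁ x ≡ proj₁ y → x ≡ y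
  dense-≡ = Σ-≡ Dense-irrelevant

  denseAlg-isCIRL : IsCIRL denseAlg
  denseAlg-isCIRL = record
    { ⊔-assoc = λ _ _ _ → dense-≡ (⊔-assoc _ _ _)
    ; ⊓-assoc = λ _ _ _ → dense-≡ (⊓-assoc _ _ _)
    ; ⊔-comm  = λ _ _ → dense-≡ (⊔-comm _ _)
    ; ⊓-comm  = λ _ _ → dense-≡ (⊓-comm _ _)
    ; ⊔-absorbs-⊓ = λ _ _ → dense-≡ (⊔-absorbs-⊓ _ _)
    ; ⊓-absorbs-⊔ = λ _ _ → dense-≡ (⊓-absorbs-⊔ _ _)
    ; ·-assoc = λ _ _ _ → dense-≡ (·-assoc _ _ _)
    ; ·-comm  = λ _ _ → dense-≡ (·-comm _ _)
    ; ·-identity = λ _ → dense-≡ (·-identity _)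
    ; residuation₁ = λ x _ _ p → dense-≡ (⊓-glb (curry (cong proj₁ p)) (proj₁ (proj₂ x)))
    ; residuation₂ = λ _ _ _ p → dense-≡ (uncurry (≼-trans (cong proj₁ p) x⊓y≼x))
    } , λ x → dense-≡ (proj₁ (proj₂ x))

  densePartOf : DensePart denseAlg C
  densePartOf = record
    { g         = proj₁
    ; g-inj     = dense-≡
    ; g-⊔       = λ _ _ → refl
    ; g-⊓       = λ _ _ → refl
    ; g-·       = λ _ _ → refl
    ; g-⇒       = λ _ _ → refl
    ; g-e       = refl
    ; densify-g = λ (x , x≼e , ¬x≡z) → trans
        (cong₂ _⊔_ x≼e (trans (cong (neg C) x≼e) ¬x≡z)) (trans (⊔-comm x z) (≼⇒⊔≡ z≼))
    ; densified = λ x → (densify C x , Dense-x⊔¬x x⊓y≼y) , refl }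

  private
    E = Alg.Carrier denseAlg

  -- In general 0 and the dense elements need not exhaust the negative cone, and in a trivial `C`
  -- they collide. Injectivity and surjectivity are established for subdirectly irreducible
  -- algebras, in `embed-injective` and `classify`.
  embed : Hom (2⊕ denseAlg) negAlg
  embed = record
    { to    = emb
    ; ⊔-hom = λ { nothing _ → neg-≡ (sym (≼⇒⊔≡ z≼))
                ; (just _) nothing → neg-≡ (sym (trans (⊔-comm _ z) (≼⇒⊔≡ z≼)))
                ; (just _) (just _) → refl }
    ; ⊓-hom = λ { nothing _ → neg-≡ (sym z≼)
                ; (just _) nothing → neg-≡ (sym (trans (⊓-comm _ z) z≼))
                ; (just _) (just _) → neg-≡ refl }
    ; ·-hom = λ { nothing _ → neg-≡ (sym (z·x _))
                ; (just _) nothing → neg-≡ (sym (trans (·-comm _ z) (z·x _)))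
                ; (just _) (just _) → neg-≡ refl }
    ; ⇒-hom = λ { nothing _ → neg-≡ (sym (≼-antisym x⊓y≼y (⊓-glb (e≼⇒ z≼) ≼-refl)))
                ; (just (_ , _ , ¬x≡z)) nothing → neg-≡ (sym ¬x≡z)
                ; (just _) (just _) → refl }
    ; e-hom = refl
    ; z-hom = refl }
    where
    emb : Maybe E → Alg.Carrier negAlg
    emb nothing        = z , z≼
    emb (just (x , p)) = x , proj₁ p

  embedK : Hom (K (2⊕ denseAlg)) (K negAlg)
  embedK = K-hom embed

  Realizes : Carrier → Maybe E × Maybe E → Set
  Realizes x p = to twist x ≡ to embedK p

  realizes-∼ : ∀ {x} a b → Realizes x (a , b) → Realizes (x ⇒ e) (b , a)
  realizes-∼ {x} a b eq = cong₂ _,_ (cong proj₂ eq)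
    (trans (neg-≡ (cong (_⊓ e) (∼∼ x))) (cong proj₁ eq))

  realizes-dense : ∀ d → Realizes (proj₁ d) (just d , just (e , Dense-e))
  realizes-dense (x , x≼e , _) = cong₂ _,_ (neg-≡ x≼e) (neg-≡ (ngt-≼e x≼e))

  realizes-just-nothing : ∀ d → Realizes (proj₁ d · (z ⇒ e)) (just d , nothing)
  realizes-just-nothing d@(x , x≼e , ¬x≡z) = trans (Hom.·-hom twist x (z ⇒ e)) (trans
    (cong₂ (Alg._·_ (K negAlg)) (realizes-dense d) (realizes-∼ nothing (just (e , Dense-e)) (Hom.z-hom twist)))
    (cong₂ _,_ (neg-≡ (·-identityʳ x))
      (neg-≡ (trans (cong₂ _⊓_ ¬x≡z (imp⁻-e ≼-refl)) z≼))))

  -- The generation of `K₀ (2⊕ D)` from its negative cone, repeated with elements of `C`.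
  realize : ∀ p → NonZero₂ p → ∃ λ x → Realizes x p
  realize (just d  , nothing) _ = _ , realizes-just-nothing d
  realize (nothing , just d ) _ = _ , realizes-∼ (just d) nothing (realizes-just-nothing d)
  realize (just d  , just d′) _ = (proj₁ d · (z ⇒ e)) ⊓ (proj₁ d′ ⇒ e) ,
    trans (Hom.⊓-hom twist _ _) (trans
      (cong₂ (Alg._⊓_ (K negAlg)) (realizes-just-nothing d) (realizes-∼ (just d′) (just (e , Dense-e)) (realizes-dense d′)))
      (cong₂ _,_ (neg-≡ (proj₁ (proj₂ d))) (neg-≡ (≼⇒⊔≡ z≼))))

  bool : ¬ (z ≡ e) → Σ (Hom 𝟚ᵇ negAlg) Injective
  bool z≢e = record
    { to    = val
    ; ⊔-hom = λ { true true → neg-≡ (sym (≼⇒⊔≡ ≼-refl)) ; true false → neg-≡ (sym (trans (⊔-comm e z) (≼⇒⊔≡ z≼)))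
                ; false _ → neg-≡ (sym (≼⇒⊔≡ z≼)) }
    ; ⊓-hom = λ { true true → neg-≡ (sym ≼-refl) ; true false → neg-≡ (sym (trans (⊓-comm e z) z≼))
                ; false _ → neg-≡ (sym z≼) }
    ; ·-hom = λ { true _ → neg-≡ (sym (·-identity _)) ; false _ → neg-≡ (sym (z·x _)) }
    ; ⇒-hom = λ { true true → neg-≡ (sym (imp⁻-e ≼-refl)) ; true false → neg-≡ (sym ¬e≡z)
                ; false _ → neg-≡ (sym (≼-antisym x⊓y≼y (⊓-glb (e≼⇒ z≼) ≼-refl))) }
    ; e-hom = refl
    ; z-hom = refl } , inj
    where
    val : Bool → Alg.Carrier negAlg
    val true  = e , ≼-refl
    val false = z , z≼
    inj : ∀ {x y} → val x ≡ val y → x ≡ y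
    inj {true}  {true}  _  = refl
    inj {false} {false} _  = refl
    inj {true}  {false} eq = contradiction (sym (cong proj₁ eq)) z≢e
    inj {false} {true}  eq = contradiction (cong proj₁ eq) z≢e

  -- An element with pos x = ngt x = 0 completes {0 , 1 , ∼ 0} to a copy of K₄.
  Sat⇒SatK₄ : ¬ (z ≡ e) → (∃ λ x → pos x ≡ z × ngt x ≡ z) → ∀ ε → Sat C ε → Sat K₄ ε
  Sat⇒SatK₄ z≢e (x , pos≡z , ngt≡z) (s , t) sat ρ =
      K-injective h (proj₂ (bool z≢e)) (realized-Sat h s t sat ρ (λ i → preimage (ρ i)))
    where
    h = proj₁ (bool z≢e)
    preimage : ∀ p → ∃ λ y → to twist y ≡ to (K-hom h) p
    preimage (true  , true ) = e , Hom.e-hom twist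
    preimage (false , true ) = z , Hom.z-hom twist
    preimage (true  , false) = (z ⇒ e) , cong₂ _,_ (cong proj₂ (Hom.z-hom twist))
      (trans (neg-≡ (cong (_⊓ e) (∼∼ z))) (cong proj₁ (Hom.z-hom twist)))
    preimage (false , false) = x , cong₂ _,_ (neg-≡ pos≡z) (neg-≡ ngt≡z)

  -- Identities of K₀ (2 ⊕ D), for D the dense part, hold for arguments each of whose
  -- coordinates is 0 or dense.  An arbitrary argument is moved there one variable at a time:
  -- with a = pos x, modulo the filter of ¬ a we have a ≡ 0, and modulo that of ¬¬ a we have
  -- a ≡ a ∨ ¬ a, which is dense; likewise for ngt x.  The case where both vanish is excluded
  -- by the hypothesis on C.
  module Splitting (nonzero : ∀ x → neg C (pos x) · neg C (ngt x) ≡ z) where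

    Good : Carrier → Set
    Good x = ∃ λ p → NonZero₂ p × Realizes x p

    Good-e : Good e
    Good-e = (just (e , Dense-e) , just (e , Dense-e)) , tt , realizes-dense (e , Dense-e)

    good-Sat : ∀ s t → Sat₀ denseAlg (s , t) → ∀ ρ → (∀ i → Good (ρ i)) → eval C ρ s ≡ eval C ρ t
    good-Sat s t sat ρ good = twist-injective (trans (lift s)
        (trans (cong (to embedK) (sat σ (λ i → proj₁ (proj₂ (good i))))) (sym (lift t))))
      where
      σ = λ i → proj₁ (good i)
      lift : ∀ r → to twist (eval C ρ r) ≡ to embedK (eval (K (2⊕ denseAlg)) σ r)
      lift r = trans (eval-hom twist ρ r) (trans (eval-congruent ≡-Cong (λ i → proj₂ (proj₂ (good i))) r)
                 (sym (eval-hom embedK σ r)))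

    -- m is the value to which x is moved modulo the filter of u (nothing stands for 0).
    data Moves (x u : Carrier) : Maybe E → Set where
      toZero  : u · x ≡ z → Moves x u nothing
      toDense : ∀ {d} → u · x ≡ u · proj₁ d → Moves x u (just d)

    moves : ∀ {x u m} → Moves x u m → u · x ≡ u · proj₁ (to embed m)
    moves (toZero eq)  = trans eq (sym (trans (·-comm _ z) (z·x _)))
    moves (toDense eq) = eq

    ¬-moves : ∀ x → Moves x (neg C x) nothing
    ¬-moves x = toZero ¬x·x

    ¬¬-moves : ∀ {x} (x≼e : x ≼ e) → Moves x (neg C (neg C x)) (just (x ⊔ neg C x , Dense-x⊔¬x x≼e))
    ¬¬-moves {x} x≼e = toDense (sym (trans (·-distribˡ-⊔ (neg C (neg C x)) x (neg C x)) (trans (cong (neg C (neg C x) · x ⊔_) ¬x·x)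
      (trans (⊔-comm _ z) (≼⇒⊔≡ z≼)))))

    module _ (s t : Term true) (sat : Sat₀ denseAlg (s , t)) where

      Agree : Carrier → (ℕ → Carrier) → Set
      Agree c ρ = c · eval C ρ s ≡ c · eval C ρ t

      -- The variables below n are still arbitrary. Quantifying over c lets each split pass its
      -- factors on to the next variable.
      AgreeFrom : ℕ → Set
      AgreeFrom n = ∀ ρ → (∀ i → n ℕ.≤ i → Good (ρ i)) → ∀ {c} → IsIdempotent c → Agree c ρ

      agree-zero : AgreeFrom 0
      agree-zero ρ good {c} _ = cong (c ·_) (good-Sat s t sat ρ (λ i → good i ℕ.z≤n))

      module _ {n} (IH : AgreeFrom n) (ρ : ℕ → Carrier) (good : ∀ i → suc n ℕ.≤ i → Good (ρ i)) where

        -- Modulo the filter of c · u · v, `ρ n` may be replaced by an element realizing (p , q): u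
        -- corrects `pos`, v corrects `ngt`, and these two determine an element modulo any
        -- congruence.
        agree-moved : ∀ {c u v p q} → IsIdempotent c → IsIdempotent u → IsIdempotent v →
                      Moves (pos (ρ n)) u p → Moves (ngt (ρ n)) v q → NonZero₂ (p , q) →
                      Agree ((c · u) · v) ρ
        agree-moved {c} {u} {v} {p} {q} ic iu iv mp mq nz with realize (p , q) nz
        ... | y , real = trans (eval-congruent θ ρ~ρ′ s)
                (trans (IH ρ′ good′ idem) (sym (eval-congruent θ ρ~ρ′ t)))
          where
          idem = ·-idempotent (·-idempotent ic iu) iv
          θ = filterCong idem
          ρ′ = ρ [ n ↦ y ]
          good′ : ∀ i → n ℕ.≤ i → Good (ρ′ i)
          good′ = update-elim ρ n y (λ i x → n ℕ.≤ i → Good x) (λ _ → (p , q) , nz , real)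
            (λ i i≢n n≤i → good i (ℕ.≤∧≢⇒< n≤i (λ eq → i≢n (sym eq))))
          pos-moved : ((c · u) · v) · pos (ρ n) ≡ ((c · u) · v) · pos y
          pos-moved = trans (rearrange _) (trans (cong ((c · v) ·_)
            (trans (moves mp) (cong (u ·_) (sym (cong (λ r → proj₁ (proj₁ r)) real))))) (sym (rearrange _)))
            where
            rearrange : ∀ w → ((c · u) · v) · w ≡ (c · v) · (u · w)
            rearrange w = trans (·-assoc _ v w) (·-·-swap c u v w)
          ngt-moved : ((c · u) · v) · ngt (ρ n) ≡ ((c · u) · v) · ngt y
          ngt-moved = trans (·-assoc _ v _) (trans (cong ((c · u) ·_)
            (trans (moves mq) (cong (v ·_) (sym (cong (λ r → proj₁ (proj₂ r)) real))))) (sym (·-assoc _ v _)))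
          ρ~ρ′ : ∀ i → Cong.θ θ (ρ i) (ρ′ i)
          ρ~ρ′ = update-elim ρ n y (λ i x → Cong.θ θ (ρ i) x)
            (pos-ngt-congruent θ pos-moved ngt-moved) (λ _ _ → refl)

        -- Stone's law for a and b leaves four cases. In three of them `agree-moved` applies;
        -- `realize` offers nothing for (0 , 0), but there the factor c · ¬ a · ¬ b is itself 0.
        agree-suc : ∀ {c} → IsIdempotent c → Agree c ρ
        agree-suc {c} ic = split-· c S T (stone a≼e)
            (split-· (c · ¬a) S T (stone b≼e) (zero-zero S T)
              (agree-moved ic (¬-idempotent a≼e) (¬¬-idempotent b≼e) (¬-moves a) (¬¬-moves b≼e) tt))
            (split-· (c · ¬¬a) S T (stone b≼e)
              (agree-moved ic (¬¬-idempotent a≼e) (¬-idempotent b≼e) (¬¬-moves a≼e) (¬-moves b) tt)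
              (agree-moved ic (¬¬-idempotent a≼e) (¬¬-idempotent b≼e) (¬¬-moves a≼e) (¬¬-moves b≼e) tt))
          where
          S = eval C ρ s
          T = eval C ρ t
          a = pos (ρ n)
          b = ngt (ρ n)
          a≼e : a ≼ e
          a≼e = x⊓y≼y
          b≼e : b ≼ e
          b≼e = x⊓y≼y
          ¬a = neg C a
          ¬¬a = neg C ¬a
          c¬a¬b≡z : (c · ¬a) · neg C b ≡ z
          c¬a¬b≡z = trans (·-assoc c _ _) (trans (cong (c ·_) (nonzero (ρ n))) (trans (·-comm c z) (z·x c)))
          zero-zero : ∀ x y → ((c · ¬a) · neg C b) · x ≡ ((c · ¬a) · neg C b) · y
          zero-zero x y = trans (cong (_· x) c¬a¬b≡z) (trans (z·x x)
            (sym (trans (cong (_· y) c¬a¬b≡z) (z·x y))))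

      agree-from : ∀ n → AgreeFrom n
      agree-from zero    = agree-zero
      agree-from (suc n) ρ good = agree-suc (agree-from n) ρ good

      Sat₀-dense⇒Sat : Sat C (s , t)
      Sat₀-dense⇒Sat ρ = trans (truncated s (ℕ.m≤m⊔n _ _)) (trans (trans (sym (·-identity _))
          (trans (agree-from n ρ′ good e-idempotent) (·-identity _))) (sym (truncated t (ℕ.m≤n⊔m _ _))))
        where
        n = varBound s ℕ.⊔ varBound t
        ρ′ = truncate C n ρ
        good : ∀ i → n ℕ.≤ i → Good (ρ′ i)
        good i n≤i = subst Good (sym (truncate-≥ C n ρ n≤i)) Good-e
        truncated : ∀ r → varBound r ℕ.≤ n → eval C ρ r ≡ eval C ρ′ r
        truncated r r≤n = eval-agree C r n r≤n (λ i i<n → sym (truncate-< C n ρ i<n))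

-- Residuation and the Stone law carry premises, so they must first be recast as identities: x · y ≤
-- w is absorbed by writing x · y ∨ w for w, and x ≤ 1 by writing x ∧ 1 for x.
InKSRL-transfer : ∀ {A C} → (∀ ε → Sat A ε → Sat C ε) → InKSRL A → InKSRL C
InKSRL-transfer {A} {C} A⊆C inKSRL = record
  { isCRL = record
    { ⊔-assoc = λ x y w → law ((X ∨ₜ Y) ∨ₜ W) (X ∨ₜ (Y ∨ₜ W)) (λ ρ → A.⊔-assoc (ρ 0) (ρ 1) (ρ 2)) x y w
    ; ⊓-assoc = λ x y w → law ((X ∧ₜ Y) ∧ₜ W) (X ∧ₜ (Y ∧ₜ W)) (λ ρ → A.⊓-assoc (ρ 0) (ρ 1) (ρ 2)) x y w
    ; ⊔-comm = ⊔-comm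
    ; ⊓-comm = ⊓-comm
    ; ⊔-absorbs-⊓ = ⊔-absorbs-⊓
    ; ⊓-absorbs-⊔ = ⊓-absorbs-⊔
    ; ·-assoc = λ x y w → law ((X ·ₜ Y) ·ₜ W) (X ·ₜ (Y ·ₜ W)) (λ ρ → A.·-assoc (ρ 0) (ρ 1) (ρ 2)) x y w
    ; ·-comm = λ x y → law (X ·ₜ Y) (Y ·ₜ X) (λ ρ → A.·-comm (ρ 0) (ρ 1)) x y y
    ; ·-identity = λ x → law (oneₜ ·ₜ X) X (λ ρ → A.·-identity (ρ 0)) x x x
    ; residuation₁ = λ x y w p → trans (cong (λ v → x ⊓ (y ⇒ v)) (sym (≤⇒⊔≡ p)))
        (law (X ∧ₜ (Y ⇒ₜ ((X ·ₜ Y) ∨ₜ W))) X (λ _ → A.curry A.x≼x⊔y) x y w)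
    ; residuation₂ = λ x y w p → trans (cong ((x · y) ⊓_) (sym (≤⇒⊔·≡ x y w p))) (⊓-absorbs-⊔ _ _)
    }
  ; bottom = λ x → law (zerₜ ∧ₜ X) zerₜ (λ _ → A.z≼) x x x
  ; ∼∼ = λ x → law ((X ⇒ₜ oneₜ) ⇒ₜ oneₜ) X (λ ρ → A.∼∼ (ρ 0)) x x x
  ; dist₁ᵃ = λ x y → law (oneₜ ∧ₜ (X ∨ₜ Y)) ((oneₜ ∧ₜ X) ∨ₜ (oneₜ ∧ₜ Y)) (λ ρ → A.dist₁ᵃ (ρ 0) (ρ 1)) x y y
  ; dist₁ᵇ = λ x y → law (X ∧ₜ (oneₜ ∨ₜ Y)) ((X ∧ₜ oneₜ) ∨ₜ (X ∧ₜ Y)) (λ ρ → A.dist₁ᵇ (ρ 0) (ρ 1)) x y y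
  ; dist₁ᶜ = λ x y → law (X ∧ₜ (Y ∨ₜ oneₜ)) ((X ∧ₜ Y) ∨ₜ (X ∧ₜ oneₜ)) (λ ρ → A.dist₁ᶜ (ρ 0) (ρ 1)) x y y
  ; dist₂ᵃ = λ x y → law (oneₜ ∨ₜ (X ∧ₜ Y)) ((oneₜ ∨ₜ X) ∧ₜ (oneₜ ∨ₜ Y)) (λ ρ → A.dist₂ᵃ (ρ 0) (ρ 1)) x y y
  ; dist₂ᵇ = λ x y → law (X ∨ₜ (oneₜ ∧ₜ Y)) ((X ∨ₜ oneₜ) ∧ₜ (X ∨ₜ Y)) (λ ρ → A.dist₂ᵇ (ρ 0) (ρ 1)) x y y
  ; dist₂ᶜ = λ x y → law (X ∨ₜ (Y ∧ₜ oneₜ)) ((X ∨ₜ Y) ∧ₜ (X ∨ₜ oneₜ)) (λ ρ → A.dist₂ᶜ (ρ 0) (ρ 1)) x y y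
  ; ·-neg = λ x y → law ((X ·ₜ Y) ∧ₜ oneₜ) ((X ∧ₜ oneₜ) ·ₜ (Y ∧ₜ oneₜ)) (λ ρ → A.·-neg (ρ 0) (ρ 1)) x y y
  ; ⇒-split = λ x y → law (((X ∧ₜ oneₜ) ⇒ₜ Y) ∧ₜ (((Y ⇒ₜ oneₜ) ∧ₜ oneₜ) ⇒ₜ (X ⇒ₜ oneₜ))) (X ⇒ₜ Y)
                      (λ ρ → A.⇒-split (ρ 0) (ρ 1)) x y y
  } , λ x x≤e → subst (λ v → neg C v ⊔ neg C (neg C v) ≡ e) x≤e
        (law (negₜ (X ∧ₜ oneₜ) ∨ₜ negₜ (negₜ (X ∧ₜ oneₜ))) oneₜ (λ _ → A.stone A.x⊓y≼y) x x x)
  where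
  module A = StoneKLattice A inKSRL
  open Alg C
  X Y W : Term true
  X = var 0
  Y = var 1
  W = var 2
  triple : ∀ {X : Set} → X → X → X → ℕ → X
  triple x y w 0 = x
  triple x y w 1 = y
  triple x y w _ = w
  law : ∀ s t → Sat A (s , t) → ∀ x y w → eval C (triple x y w) s ≡ eval C (triple x y w) t
  law s t h x y w = A⊆C (s , t) h (triple x y w)
  ⊔-comm : ∀ x y → x ⊔ y ≡ y ⊔ x
  ⊔-comm x y = law (X ∨ₜ Y) (Y ∨ₜ X) (λ ρ → A.⊔-comm (ρ 0) (ρ 1)) x y y
  ⊓-comm : ∀ x y → x ⊓ y ≡ y ⊓ x
  ⊓-comm x y = law (X ∧ₜ Y) (Y ∧ₜ X) (λ ρ → A.⊓-comm (ρ 0) (ρ 1)) x y y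
  ⊔-absorbs-⊓ : ∀ x y → x ⊔ (x ⊓ y) ≡ x
  ⊔-absorbs-⊓ x y = law (X ∨ₜ (X ∧ₜ Y)) X (λ ρ → A.⊔-absorbs-⊓ (ρ 0) (ρ 1)) x y y
  ⊓-absorbs-⊔ : ∀ x y → x ⊓ (x ⊔ y) ≡ x
  ⊓-absorbs-⊔ x y = law (X ∧ₜ (X ∨ₜ Y)) X (λ ρ → A.⊓-absorbs-⊔ (ρ 0) (ρ 1)) x y y
  ≤⇒⊔≡ : ∀ {x y} → x ⊓ y ≡ x → x ⊔ y ≡ y
  ≤⇒⊔≡ {x} {y} p = trans (⊔-comm x y) (trans (cong (y ⊔_) (trans (sym p) (⊓-comm x y))) (⊔-absorbs-⊓ y x))
  -- x · y ∨ w = x · y ∨ (y → w) · y ∨ w = (x ∨ (y → w)) · y ∨ w = (y → w) · y ∨ w = w.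
  ≤⇒⊔·≡ : ∀ x y w → x ⊓ (y ⇒ w) ≡ x → (x · y) ⊔ w ≡ w
  ≤⇒⊔·≡ x y w p = trans (cong ((x · y) ⊔_) (sym (mp x y w))) (trans
      (law ((X ·ₜ Y) ∨ₜ (((Y ⇒ₜ W) ·ₜ Y) ∨ₜ W)) (((X ∨ₜ (Y ⇒ₜ W)) ·ₜ Y) ∨ₜ W)
        (λ ρ → trans (sym (A.⊔-assoc _ _ _)) (cong (λ v → Alg._⊔_ A v (ρ 2)) (sym (A.·-distribʳ-⊔ (ρ 1) (ρ 0) _)))) x y w)
      (trans (cong (λ v → (v · y) ⊔ w) (≤⇒⊔≡ p)) (mp x y w)))
    where
    mp : ∀ x y w → ((y ⇒ w) · y) ⊔ w ≡ w
    mp = law (((Y ⇒ₜ W) ·ₜ Y) ∨ₜ W) W (λ _ → A.≼⇒⊔≡ A.modusPonens)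

-- Covers

𝟚-isCIRL : IsCIRL 𝟚
𝟚-isCIRL = record
  { ⊔-assoc = Bool.∨-assoc
  ; ⊓-assoc = Bool.∧-assoc
  ; ⊔-comm  = Bool.∨-comm
  ; ⊓-comm  = Bool.∧-comm
  ; ⊔-absorbs-⊓ = Bool.∨-abs-∧
  ; ⊓-absorbs-⊔ = Bool.∧-abs-∨
  ; ·-assoc = Bool.∧-assoc
  ; ·-comm  = Bool.∧-comm
  ; ·-identity = Bool.∧-identityˡ
  ; residuation₁ = λ { false _ _ _ → refl ; true false _ _ → refl ; true true true _ → refl }
  ; residuation₂ = λ { false _ _ _ → refl ; true false _ _ → refl ; true true true _ → refl }
  } , Bool.∧-identityʳ

𝟚-integral : Integral 𝟚
𝟚-integral = IsCIRL⇒Integral 𝟚-isCIRL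

-- For integral `D` its value in `K (2⊕ D)` is 1 at (0 , 0) and 0 elsewhere.
bothZeroₜ : Term true → Term true
bothZeroₜ x = negₜ (x ∧ₜ oneₜ) ·ₜ negₜ ((x ⇒ₜ oneₜ) ∧ₜ oneₜ)

neverBothZero : Identity true
neverBothZero = bothZeroₜ (var 0) , zerₜ

-- Separates V(K₈) ∨ V(K₄) from V(K (2 ⊕ D)) for nontrivial D.
bothZero⇒boolean : Identity true
bothZero⇒boolean = bothZeroₜ (var 0) ·ₜ denseₜ (var 1) , bothZeroₜ (var 0)

module _ {D : Alg false} (int : Integral D) where
  open Alg D
  open Integral int

  ⇒⊔-e : ∀ x y → (x ⇒ (y ⊔ e)) ≡ e
  ⇒⊔-e x y = trans (cong (x ⇒_) (⊔-e y)) (⇒-e x)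

  Sat₀-neverBothZero : Sat₀ D neverBothZero
  Sat₀-neverBothZero ρ nz = cases (ρ 0) (nz 0)
    where
    cases : ∀ p → NonZero₂ p → eval (K (2⊕ D)) (λ _ → p) (bothZeroₜ (var 0)) ≡ Alg.z (K (2⊕ D))
    cases (just _  , nothing) _ = cong₂ _,_ refl (cong just (trans (cong (e ⊓_) (⇒⊔-e _ _)) (⊓-e e)))
    cases (just _  , just _ ) _ = cong₂ _,_ refl (cong just (⊓-e e))
    cases (nothing , just _ ) _ = cong₂ _,_ refl (cong just (trans (⊓-e _) (⇒⊔-e _ _)))

  z·-K : ∀ p → Alg._·_ (K (2⊕ D)) (Alg.z (K (2⊕ D))) p ≡ Alg.z (K (2⊕ D))
  z·-K (nothing , b) = cong₂ _,_ refl (cong just (⊓-e e))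
  z·-K (just a  , b) = cong₂ _,_ refl (cong just (trans (cong (e ⊓_) (⇒-e a)) (⊓-e e)))

  Sat₀-bothZero⇒boolean : Sat₀ D bothZero⇒boolean
  Sat₀-bothZero⇒boolean ρ nz = trans (cong (λ p → p KD.· eval (K (2⊕ D)) ρ (denseₜ (var 1))) bz≡z)
      (trans (z·-K (eval (K (2⊕ D)) ρ (denseₜ (var 1)))) (sym bz≡z))
    where
    module KD = Alg (K (2⊕ D))
    bz≡z = Sat₀-neverBothZero ρ nz

-- The first factor may be 1 here, but the negative cone of `K₄` is Boolean and `denseₜ` is
-- constantly 1. In `K₀ (2⊕ D)` the reason is the opposite one: `bothZeroₜ` is constantly 0.
SatK₄-bothZero⇒boolean : Sat K₄ bothZero⇒boolean
SatK₄-bothZero⇒boolean ρ = trans (cong (bz K₄.·_) (boolean (ρ 1))) (identity bz)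
  where
  module K₄ = Alg K₄
  bz = eval K₄ ρ (bothZeroₜ (var 0))
  boolean : ∀ p → densify K₄ p ≡ K₄.e
  boolean (true  , true ) = refl
  boolean (true  , false) = refl
  boolean (false , true ) = refl
  boolean (false , false) = refl
  identity : ∀ p → p K₄.· K₄.e ≡ p
  identity (true  , true ) = refl
  identity (true  , false) = refl
  identity (false , true ) = refl
  identity (false , false) = refl

¬SatK₄-neverBothZero : ¬ Sat K₄ neverBothZero
¬SatK₄-neverBothZero sat with sat (λ _ → false , false)
... | ()

ThK₈⇒Sat₀𝟚 : ∀ ε → ThK₈ ε → Sat₀ 𝟚 ε
ThK₈⇒Sat₀𝟚 = SatK₀⇒Sat₀ 𝟚-integral

Sat₀𝟚⇒ThK₈ : ∀ ε → Sat₀ 𝟚 ε → ThK₈ ε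
Sat₀𝟚⇒ThK₈ = Sat₀⇒SatK₀ 𝟚-integral

-- A and K₀ (2 ⊕ D) generate the same variety.
record SameTheory (A : Alg true) (D : Alg false) : Set where
  field
    down : ∀ ε → Sat A ε → Sat₀ D ε
    up   : ∀ ε → Sat₀ D ε → Sat A ε

module _ {A : Alg true} {D : Alg false} (int : Integral D) (same : SameTheory A D) where
  open SameTheory same

  cover-down : CoversV (Sat A) ThK₈ → CoversV (Sat D) (Sat 𝟚)
  cover-down (A⊆K₈ , K₈⊈A , between) = D⊆𝟚 , 𝟚⊈D , between′
    where
    D⊆𝟚 : ∀ ε → Sat D ε → Sat 𝟚 ε
    D⊆𝟚 ε sat = Sat₀-star⇒Sat 𝟚-integral ε (ThK₈⇒Sat₀𝟚 (star² ε)
      (A⊆K₈ (star² ε) (up (star² ε) (Sat⇒Sat₀-star int ε sat))))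
    𝟚⊈D : ¬ (∀ ε → Sat 𝟚 ε → Sat D ε)
    𝟚⊈D 𝟚⊆D = K₈⊈A λ ε sat → up ε (Sat₀-mono 𝟚 D 𝟚⊆D ε (ThK₈⇒Sat₀𝟚 ε sat))
    between′ : ∀ (Γ : Identity false → Set) → (∀ ε → Γ ε → Sat 𝟚 ε) →
               (∀ C → Mod Γ C → ∀ ε → Sat D ε → Sat C ε) →
               (∀ C → Mod Γ C → ∀ ε → Sat 𝟚 ε → Sat C ε) ⊎ (∀ ε → Γ ε → Sat D ε)
    between′ Γ Γ⊆𝟚 D⊆Γ = result (between Γ* Γ*⊆K₈ (λ C mod ε sat → mod ε (inj₁ sat)))
      where
      Γ* : Identity true → Set
      -- The summand `Sat A` keeps the models of `Γ*` inside V(A), as the cover hypothesis demands.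
      Γ* η = Sat A η ⊎ ∃ λ ε → Γ ε × η ≡ star² ε
      Γ*⊆K₈ : ∀ η → Γ* η → ThK₈ η
      Γ*⊆K₈ η (inj₁ sat) = A⊆K₈ η sat
      Γ*⊆K₈ _ (inj₂ (ε , ε∈Γ , refl)) = Sat₀𝟚⇒ThK₈ (star² ε) (Sat⇒Sat₀-star 𝟚-integral ε (Γ⊆𝟚 ε ε∈Γ))
      result : (∀ C → Mod Γ* C → ∀ η → ThK₈ η → Sat C η) ⊎ (∀ η → Γ* η → Sat A η) →
               (∀ C → Mod Γ C → ∀ ε → Sat 𝟚 ε → Sat C ε) ⊎ (∀ ε → Γ ε → Sat D ε)
      result (inj₂ Γ*⊆A) = inj₂ λ ε ε∈Γ → Sat₀-star⇒Sat int ε (down (star² ε) (Γ*⊆A (star² ε) (inj₂ (ε , ε∈Γ , refl))))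
      result (inj₁ K₈⊆Γ*) = inj₁ λ C mod ε sat → Sat₀-star⇒Sat (intC C mod) ε (Sat⇒Sat₀ C (star² ε)
          (K₈⊆Γ* (K₀-alg C) (mod* C mod) (star² ε) (Sat₀𝟚⇒ThK₈ (star² ε) (Sat⇒Sat₀-star 𝟚-integral ε sat))))
        where
        intC : ∀ C → Mod Γ C → Integral C
        intC C mod = Integral-transfer (D⊆Γ C mod) int
        mod* : ∀ C → Mod Γ C → Mod Γ* (K₀-alg C)
        mod* C mod η (inj₁ sat) = Sat₀⇒Sat C η (Sat₀-mono D C (D⊆Γ C mod) η (down η sat))
        mod* C mod _ (inj₂ (ε , ε∈Γ , refl)) = Sat₀⇒Sat C (star² ε) (Sat⇒Sat₀-star (intC C mod) ε (mod ε ε∈Γ))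

  -- If Th D and the components of Γ cut out only V(2), the dense part of each model of Γ satisfies
  -- Th 2, and `Splitting` lifts this to the model. If they hold in `D`, the identities of Γ
  -- reassemble from their components and hold in `A`.
  cover-up : InKSRL A → CoversV (Sat D) (Sat 𝟚) → CoversV (Sat A) ThK₈
  cover-up inKSRL (D⊆𝟚 , 𝟚⊈D , between) = A⊆K₈ , K₈⊈A , between′
    where
    A⊆K₈ : ∀ ε → Sat A ε → ThK₈ ε
    A⊆K₈ ε sat = Sat₀𝟚⇒ThK₈ ε (Sat₀-mono D 𝟚 D⊆𝟚 ε (down ε sat))
    K₈⊈A : ¬ (∀ ε → ThK₈ ε → Sat A ε)
    K₈⊈A K₈⊆A = 𝟚⊈D λ ε sat → Sat₀-star⇒Sat int ε
      (down (star² ε) (K₈⊆A (star² ε) (Sat₀𝟚⇒ThK₈ (star² ε) (Sat⇒Sat₀-star 𝟚-integral ε sat))))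
    between′ : ∀ (Γ : Identity true → Set) → (∀ ε → Γ ε → ThK₈ ε) →
               (∀ C → Mod Γ C → ∀ ε → Sat A ε → Sat C ε) →
               (∀ C → Mod Γ C → ∀ ε → ThK₈ ε → Sat C ε) ⊎ (∀ ε → Γ ε → Sat A ε)
    between′ Γ Γ⊆K₈ A⊆Γ = result (between Γ° Γ°⊆𝟚 (λ C mod uv sat → mod uv (inj₁ sat)))
      where
      Γ° : Identity false → Set
      Γ° uv = Sat D uv ⊎ ∃ λ ε → Γ ε × Component ε uv
      Γ°⊆𝟚 : ∀ uv → Γ° uv → Sat 𝟚 uv
      Γ°⊆𝟚 uv (inj₁ sat) = D⊆𝟚 uv sat
      Γ°⊆𝟚 uv (inj₂ (ε , ε∈Γ , c)) = component-sound 𝟚 (ThK₈⇒Sat₀𝟚 ε (Γ⊆K₈ ε ε∈Γ)) c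
      result : (∀ C → Mod Γ° C → ∀ uv → Sat 𝟚 uv → Sat C uv) ⊎ (∀ uv → Γ° uv → Sat D uv) →
               (∀ C → Mod Γ C → ∀ ε → ThK₈ ε → Sat C ε) ⊎ (∀ ε → Γ ε → Sat A ε)
      -- Since Γ holds in `K₈`, `𝟚` certifies that both sides of ε have the same zero coordinates.
      result (inj₂ Γ°⊆D) = inj₂ λ ε ε∈Γ → up ε (Sat₀-transfer 𝟚 D {ε} (ThK₈⇒Sat₀𝟚 ε (Γ⊆K₈ ε ε∈Γ))
        (λ uv c → Γ°⊆D uv (inj₂ (ε , ε∈Γ , c))))
      result (inj₁ 𝟚⊆Γ°) = inj₁ λ C mod ε sat → inMod C mod ε (ThK₈⇒Sat₀𝟚 ε sat)
        where
        module _ (C : Alg true) (mod : Mod Γ C) where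
          A⊆C : ∀ ε → Sat A ε → Sat C ε
          A⊆C = A⊆Γ C mod
          open Alg C using (_·_; z)
          open StoneKLattice C (InKSRL-transfer A⊆C inKSRL)
          nonzero : ∀ x → neg C (pos x) · neg C (ngt x) ≡ z
          nonzero x = A⊆C neverBothZero (up neverBothZero (Sat₀-neverBothZero int)) (λ _ → x)
          dense-mod : Mod Γ° denseAlg
          dense-mod uv (inj₁ sat) = DensePart.star-complete densePartOf {λ _ → ⊤} (λ _ → tt) uv
            (λ ρ _ → A⊆C (star² uv) (up (star² uv) (Sat⇒Sat₀-star int uv sat)) ρ)
          -- ε is evaluated in `C`, on elements realizing the dense pattern; the relevant coordinate
          -- is then read off.
          dense-mod uv (inj₂ ((s , t) , ε∈Γ , c)) δ = dense-≡ (cong proj₁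
            (component-value c denseAlg δ (to embed) (realized-Sat embed s t (mod (s , t) ε∈Γ) _
              (λ i → realize _ (NonZero₂-map (eval denseAlg δ) (Component.σ c i) (Component.nonzero c i))))))
          inMod : ∀ ε → Sat₀ 𝟚 ε → Sat C ε
          inMod ε@(s , t) sat = Splitting.Sat₀-dense⇒Sat nonzero s t
            (Sat₀-mono 𝟚 denseAlg (𝟚⊆Γ° denseAlg dense-mod) ε sat)

  -- Even the inclusion of V(K₄) in V(A) fails: `A` satisfies `neverBothZero`, which (0 , 0)
  -- violates in `K₄`.
  not-cover-K₄ : ¬ CoversV (Sat A) (Sat K₄)
  not-cover-K₄ (A⊆K₄ , _) = ¬SatK₄-neverBothZero (A⊆K₄ neverBothZero (up neverBothZero (Sat₀-neverBothZero int)))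

-- Finite subdirectly irreducible algebras

pullback : ∀ {b} {A B : Alg b} → Hom A B → Cong B → Cong A
pullback h φ = record
  { θ      = λ x y → θ (to h x) (to h y)
  ; refl'  = λ _ → refl' _
  ; sym'   = sym'
  ; trans' = trans'
  ; ⊔-cong = λ p q → subst₂ θ (sym (⊔-hom _ _)) (sym (⊔-hom _ _)) (⊔-cong p q)
  ; ⊓-cong = λ p q → subst₂ θ (sym (⊓-hom _ _)) (sym (⊓-hom _ _)) (⊓-cong p q)
  ; ·-cong = λ p q → subst₂ θ (sym (·-hom _ _)) (sym (·-hom _ _)) (·-cong p q)
  ; ⇒-cong = λ p q → subst₂ θ (sym (⇒-hom _ _)) (sym (⇒-hom _ _)) (⇒-cong p q) }
  where
  open Cong φ
  open Hom h using (⊔-hom; ⊓-hom; ·-hom; ⇒-hom)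

2⊕-cong : ∀ {D} → Cong D → Cong (2⊕ D)
2⊕-cong φ = record
  { θ      = Pointwise θ
  ; refl'  = λ _ → Pointwise.refl (refl' _)
  ; sym'   = Pointwise.sym sym'
  ; trans' = Pointwise.trans trans'
  ; ⊔-cong = λ { nothing q → q ; (just p) nothing → just p ; (just p) (just q) → just (⊔-cong p q) }
  ; ⊓-cong = λ { nothing q → nothing ; (just p) nothing → nothing ; (just p) (just q) → just (⊓-cong p q) }
  ; ·-cong = λ { nothing q → nothing ; (just p) nothing → nothing ; (just p) (just q) → just (·-cong p q) }
  ; ⇒-cong = λ { nothing q → just (refl' _) ; (just p) nothing → nothing ; (just p) (just q) → just (⇒-cong p q) } }
  where open Cong φ

K-cong : ∀ {B} → Cong B → Cong (K B)
K-cong φ = record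
  { θ      = λ (a , b) (c , d) → θ a c × θ b d
  ; refl'  = λ _ → refl' _ , refl' _
  ; sym'   = λ (p , q) → sym' p , sym' q
  ; trans' = λ (p , q) (r , s) → trans' p r , trans' q s
  ; ⊔-cong = λ (p , q) (r , s) → ⊔-cong p r , ⊓-cong q s
  ; ⊓-cong = λ (p , q) (r , s) → ⊓-cong p r , ⊔-cong q s
  ; ·-cong = λ (p , q) (r , s) → ·-cong p r , ⊓-cong (⇒-cong p s) (⇒-cong r q)
  ; ⇒-cong = λ (p , q) (r , s) → ⊓-cong (⇒-cong p r) (⇒-cong s q) , ·-cong p s }
  where open Cong φ

totalCong : ∀ {b} {A : Alg b} → Cong A
totalCong = record
  { θ = λ _ _ → ⊤ ; refl' = λ _ → tt ; sym' = λ _ → tt ; trans' = λ _ _ → tt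
  ; ⊔-cong = λ _ _ → tt ; ⊓-cong = λ _ _ → tt ; ·-cong = λ _ _ → tt ; ⇒-cong = λ _ _ → tt }

subset-finite : ∀ n {P : Fin n → Set} → (∀ i → Dec (P i)) → (∀ {i} (p q : P i) → p ≡ q) →
                ∃ λ m → Σ (Fin n) P ↔ Fin m
subset-finite zero    dec irr = 0 , mk↔ₛ′ proj₁ (λ ()) (λ ()) (λ ())
subset-finite (suc n) {P} dec irr with dec zero | subset-finite n (λ i → dec (suc i)) irr
... | yes p | m , iso = suc m , mk↔ₛ′ to′ from′ to-from from-to
  where
  open Inverse iso using () renaming (to to f; from to g; strictlyInverseˡ to f-g; strictlyInverseʳ to g-f)
  shift : Σ (Fin n) (λ i → P (suc i)) → Σ (Fin (suc n)) P
  shift (i , q) = suc i , q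
  to′ : Σ (Fin (suc n)) P → Fin (suc m)
  to′ (zero  , _) = zero
  to′ (suc i , q) = suc (f (i , q))
  from′ : Fin (suc m) → Σ (Fin (suc n)) P
  from′ zero    = zero , p
  from′ (suc j) = shift (g j)
  to-from : ∀ j → to′ (from′ j) ≡ j
  to-from zero    = refl
  to-from (suc j) = cong suc (f-g j)
  from-to : ∀ x → from′ (to′ x) ≡ x
  from-to (zero  , q) = cong (zero ,_) (irr p q)
  from-to (suc i , q) = cong shift (g-f (i , q))
... | no ¬p | m , iso = m , mk↔ₛ′ to′ from′ (Inverse.strictlyInverseˡ iso) from-to
  where
  shift : Σ (Fin n) (λ i → P (suc i)) → Σ (Fin (suc n)) P
  shift (i , q) = suc i , q
  to′ : Σ (Fin (suc n)) P → Fin m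
  to′ (zero  , q) = contradiction q ¬p
  to′ (suc i , q) = Inverse.to iso (i , q)
  from′ : Fin m → Σ (Fin (suc n)) P
  from′ j = shift (Inverse.from iso j)
  from-to : ∀ x → from′ (to′ x) ≡ x
  from-to (zero  , q) = contradiction q ¬p
  from-to (suc i , q) = cong shift (Inverse.strictlyInverseʳ iso (i , q))

module _ {X : Set} {n} (X↔Fin : X ↔ Fin n) where
  open Inverse X↔Fin using () renaming (to to f; from to g; strictlyInverseʳ to g-f)

  finite-≟ : (x y : X) → Dec (x ≡ y)
  finite-≟ x y = map′ (λ eq → trans (sym (g-f x)) (trans (cong g eq) (g-f y))) (cong f) (f x Fin.≟ f y)

  finite-any? : {P : X → Set} → (∀ x → Dec (P x)) → Dec (∃ P)
  finite-any? {P} P? = map′ (λ (i , p) → g i , p) (λ (x , p) → f x , subst P (sym (g-f x)) p)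
    (Fin.any? (λ i → P? (g i)))

  finite-Σ : {P : X → Set} → (∀ x → Dec (P x)) → (∀ {x} (p q : P x) → p ≡ q) → ∃ λ m → Σ X P ↔ Fin m
  finite-Σ {P} P? irr with subset-finite n (λ i → P? (g i)) irr
  ... | m , iso = m , (iso ↔-∘ ↔-sym (Σ-↔ (↔-sym X↔Fin) (↔-id _)))

module FiniteSI (A : Alg true) (inKSRL : InKSRL A) (finite : Finite A) (si : SubdirectlyIrreducible A) where
  open Alg A
  open StoneKLattice A inKSRL

  private
    D = denseAlg
    int = IsCIRL⇒Integral denseAlg-isCIRL
    module D = Alg D
    module μ = Cong (proj₁ si)
    monolith = proj₂ (proj₂ si)

  _≟_ : (x y : Carrier) → Dec (x ≡ y)
  _≟_ = finite-≟ (proj₂ finite)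

  z≢e : ¬ (z ≡ e)
  z≢e z≡e with proj₁ (proj₂ si)
  ... | p , q , _ , p≢q = p≢q (pos-ngt-injective (trans (collapse x⊓y≼y) (sym (collapse x⊓y≼y)))
                                                 (trans (collapse x⊓y≼y) (sym (collapse x⊓y≼y))))
    where
    collapse : ∀ {x} → x ≼ e → x ≡ e
    collapse x≼e = ≼-antisym x≼e (≼-respˡ z≡e z≼)

  -- The filter congruences of u and v intersect in the identity when u ∨ v = 1.
  e-join-irreducible : ∀ {u v} → IsIdempotent u → IsIdempotent v → u ⊔ v ≡ e → u ≡ e ⊎ v ≡ e
  e-join-irreducible {u} {v} iu iv u⊔v≡e with u ≟ e | v ≟ e
  ... | yes u≡e | _       = inj₁ u≡e
  ... | no  _   | yes v≡e = inj₂ v≡e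
  ... | no  u≢e | no  v≢e with proj₁ (proj₂ si)
  ...   | p , q , pμq , p≢q = contradiction
          (trans (sym (·-identity p)) (trans (split-· e p q u⊔v≡e (related iu u≢e) (related iv v≢e)) (·-identity q))) p≢q
    where
    related : ∀ {u} → IsIdempotent u → u ≢ e → (e · u) · p ≡ (e · u) · q
    related {u} iu u≢e = trans (cong (_· p) (·-identity u)) (trans
      (monolith (filterCong iu) (u , e , trans (IsIdempotent.u·u iu) (sym (·-identityʳ u)) , u≢e) p q pμq)
      (cong (_· q) (sym (·-identity u))))

  zero-or-dense : ∀ {x} → x ≼ e → x ≡ z ⊎ Dense x
  zero-or-dense {x} x≼e with e-join-irreducible (¬-idempotent x≼e) (¬¬-idempotent x≼e) (stone x≼e)
  ... | inj₁ ¬x≡e  = inj₁ (trans (sym (·-identity x)) (trans (cong (_· x) (sym ¬x≡e)) ¬x·x))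
  ... | inj₂ ¬¬x≡e = inj₂ (x≼e , trans (sym (·-identity _)) (trans (cong (_· neg A x) (sym ¬¬x≡e)) ¬x·x))

  embed-injective : Injective embed
  embed-injective {nothing} {nothing} _ = refl
  embed-injective {just d}  {just d′} eq = cong just (dense-≡ (cong proj₁ eq))
  embed-injective {nothing} {just (_ , _ , ¬d≡z)} eq =
    contradiction (trans (sym ¬d≡z) (trans (cong (neg A) (sym (cong proj₁ eq))) ¬z≡e)) z≢e
  embed-injective {just (_ , _ , ¬d≡z)} {nothing} eq =
    contradiction (trans (sym ¬d≡z) (trans (cong (neg A) (cong proj₁ eq)) ¬z≡e)) z≢e

  classify : ∀ (x : Alg.Carrier negAlg) → ∃ λ m → to embed m ≡ x
  classify (x , x≼e) with zero-or-dense x≼e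
  ... | inj₁ x≡z = nothing , neg-≡ (sym x≡z)
  ... | inj₂ d   = just (x , d) , neg-≡ refl

  idHom : ∀ {B : Alg true} → Hom B B
  idHom = record { to = λ x → x ; ⊔-hom = λ _ _ → refl ; ⊓-hom = λ _ _ → refl ; ·-hom = λ _ _ → refl
                 ; ⇒-hom = λ _ _ → refl ; e-hom = refl ; z-hom = refl }

  represent : Hom A (K (2⊕ D))
  represent = K-hom (cancelₕ embed embed-injective idHom (λ x → proj₁ (classify x)) (λ x → proj₂ (classify x))) ∘ₕ twist

  represent-realizes : ∀ x → Realizes x (to represent x)
  represent-realizes x = sym (cong₂ _,_ (proj₂ (classify _)) (proj₂ (classify _)))

  realizes⇒represent : ∀ {x p} → Realizes x p → to represent x ≡ p
  realizes⇒represent real = K-injective embed embed-injective (trans (sym (represent-realizes _)) real)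

  represent-dense : ∀ d → to represent (proj₁ d) ≡ (just d , just D.e)
  represent-dense d = realizes⇒represent (realizes-dense d)

  represent-injective : Injective represent
  represent-injective eq = twist-injective (trans (represent-realizes _)
    (trans (cong (to embedK) eq) (sym (represent-realizes _))))

  iso : (∀ x → NonZero₂ (to represent x)) → IsoToSub A (K (2⊕ D)) (K₀ (2⊕ D))
  iso nonzero = record
    { f = to represent ; f-⊔ = ⊔-hom ; f-⊓ = ⊓-hom ; f-· = ·-hom ; f-⇒ = ⇒-hom ; f-e = e-hom ; f-z = z-hom
    ; inj  = λ _ _ → represent-injective
    ; into = λ x → NonZero₂⊆K₀ int _ (nonzero x)
    ; onto = λ p p∈K₀ → Prod.map₂ realizes⇒represent (realize p (K₀⊆NonZero₂ int p∈K₀)) }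
    where open Hom represent

  dense? : ∀ x → Dec (Dense x)
  dense? x = ((x ⊓ e) ≟ x) ×-dec (neg A x ≟ z)

  denseAlg-finite : Finite D
  denseAlg-finite = finite-Σ (proj₂ finite) dense? Dense-irrelevant

  -- Otherwise the relativised identity x = 1 would hold in `A`, hence in `K₈`, and x = 1 would hold
  -- in `𝟚`.
  nontrivial-dense : (∀ ε → Sat A ε → ThK₈ ε) → ∃ λ d → d ≢ D.e
  nontrivial-dense A⊆K₈ with finite-any? (proj₂ denseAlg-finite) (λ d → ¬? (finite-≟ (proj₂ denseAlg-finite) d D.e))
  ... | yes found = found
  ... | no  none  = contradiction (Sat₀-star⇒Sat 𝟚-integral trivial (ThK₈⇒Sat₀𝟚 (star² trivial)
          (A⊆K₈ (star² trivial) (DensePart.star-sound densePartOf trivial all-e))) (λ _ → false)) λ ()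
    where
    trivial : Identity false
    trivial = var 0 , oneₜ
    all-e : Sat D trivial
    all-e δ = decidable-stable (finite-≟ (proj₂ denseAlg-finite) _ _) (λ d≢e → none (δ 0 , d≢e))

  -- φ acts on both coordinates, with 0 related only to itself. On dense elements this gives φ back,
  -- so the monolith of `A` can be compared with φ.
  extend : Cong D → Cong A
  extend φ = pullback represent (K-cong (2⊕-cong φ))

  extend-nontrivial : ∀ φ → NonTrivialCong D φ → NonTrivialCong A (extend φ)
  extend-nontrivial φ (x , y , xφy , x≢y) = proj₁ x , proj₁ y ,
    subst₂ (Cong.θ (K-cong (2⊕-cong φ))) (sym (represent-dense x)) (sym (represent-dense y))
      (just xφy , just (Cong.refl' φ _)) ,
    λ eq → x≢y (dense-≡ eq)

  -- The monolith of `A` lies below every `extend φ`, so its restriction to dense elements lies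
  -- below every φ. The restriction is nontrivial because related p ≠ q differ in `pos` or in `ngt`,
  -- and this coordinate is dense for both.
  denseAlg-SI : (∃ λ d → d ≢ D.e) → SubdirectlyIrreducible D
  denseAlg-SI (d , d≢e) = μ-dense , nontrivial , least
    where
    μ-dense : Cong D
    μ-dense = record
      { θ      = λ x y → μ.θ (proj₁ x) (proj₁ y)
      ; refl'  = λ _ → μ.refl' _
      ; sym'   = μ.sym'
      ; trans' = μ.trans'
      ; ⊔-cong = μ.⊔-cong
      ; ⊓-cong = μ.⊓-cong
      ; ·-cong = μ.·-cong
      ; ⇒-cong = λ p q → μ.⊓-cong (μ.⇒-cong p q) (μ.refl' e) }
    least : ∀ φ → NonTrivialCong D φ → ∀ x y → μ.θ (proj₁ x) (proj₁ y) → Cong.θ φ x y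
    least φ nt x y xμy = Pointwise.drop-just (proj₁ (subst₂ (Cong.θ (K-cong (2⊕-cong φ)))
      (represent-dense x) (represent-dense y) (monolith (extend φ) (extend-nontrivial φ nt) _ _ xμy)))
    -- Related elements have the same zero coordinates, because the monolith lies below the
    -- extension of the total congruence of D.
    coordinate : ∀ {m n} → Pointwise (λ _ _ → ⊤) m n → m ≢ n →
                 μ.θ (proj₁ (to embed m)) (proj₁ (to embed n)) → NonTrivialCong D μ-dense
    coordinate nothing           m≢n _  = contradiction refl m≢n
    coordinate (just {x} {y} _) m≢n xμy = x , y , xμy , λ eq → m≢n (cong just eq)
    nontrivial : NonTrivialCong D μ-dense
    nontrivial with proj₁ (proj₂ si)
    ... | p , q , pμq , p≢q = choose
      where
      same-zeros = monolith (extend totalCong) (extend-nontrivial totalCong (d , D.e , tt , d≢e)) p q pμq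
      component : (π : ∀ {X : Set} → X × X → X) {r : Carrier → Carrier} →
                  (∀ x → r x ≡ proj₁ (π (to embedK (to represent x)))) → μ.θ (r p) (r q) →
                  μ.θ (proj₁ (π (to embedK (to represent p)))) (proj₁ (π (to embedK (to represent q))))
      component π eq = subst₂ μ.θ (eq p) (eq q)
      posμ = component proj₁ (λ x → cong (λ w → proj₁ (proj₁ w)) (represent-realizes x)) (μ.⊓-cong pμq (μ.refl' e))
      ngtμ = component proj₂ (λ x → cong (λ w → proj₁ (proj₂ w)) (represent-realizes x))
               (μ.⊓-cong (μ.⇒-cong pμq (μ.refl' e)) (μ.refl' e))
      choose : NonTrivialCong D μ-dense
      choose with pos p ≟ pos q
      ... | no  pos≢ = coordinate (proj₁ same-zeros) (λ eq → pos≢ (begin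
                pos p ≡⟨ cong (λ w → proj₁ (proj₁ w)) (represent-realizes p) ⟩
                proj₁ (to embed (proj₁ (to represent p))) ≡⟨ cong (λ m → proj₁ (to embed m)) eq ⟩
                proj₁ (to embed (proj₁ (to represent q))) ≡⟨ cong (λ w → proj₁ (proj₁ w)) (represent-realizes q) ⟨
                pos q ∎)) posμ
        where open ≡-Reasoning
      ... | yes pos≡ = coordinate (proj₂ same-zeros) (λ eq → p≢q (pos-ngt-injective pos≡ (begin
                ngt p ≡⟨ cong (λ w → proj₁ (proj₂ w)) (represent-realizes p) ⟩
                proj₁ (to embed (proj₂ (to represent p))) ≡⟨ cong (λ m → proj₁ (to embed m)) eq ⟩
                proj₁ (to embed (proj₂ (to represent q))) ≡⟨ cong (λ w → proj₁ (proj₂ w)) (represent-realizes q) ⟨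
                ngt q ∎))) ngtμ
        where open ≡-Reasoning

  -- If A contains (0 , 0), then V(K₈) ∨ V(K₄) lies strictly between V(K₈) and V(A).
  represent-≢zero : CoversV (Sat A) ThK₈ → ∀ {x} → Realizes x (nothing , nothing) → ⊥
  represent-≢zero (A⊆K₈ , _ , between) {x} real =
      refute (between Γ (λ ε → proj₁) (λ C mod ε sat → mod ε (A⊆K₈ ε sat , Sat⇒SatK₄ z≢e (x , pos≡z , ngt≡z) ε sat)))
    where
    Γ : Identity true → Set
    Γ ε = ThK₈ ε × Sat K₄ ε
    pos≡z : pos x ≡ z
    pos≡z = cong (λ w → proj₁ (proj₁ w)) real
    ngt≡z : ngt x ≡ z
    ngt≡z = cong (λ w → proj₁ (proj₂ w)) real
    bothZero≡e : neg A (pos x) · neg A (ngt x) ≡ e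
    bothZero≡e = trans (cong₂ _·_ (trans (cong (neg A) pos≡z) ¬z≡e) (trans (cong (neg A) ngt≡z) ¬z≡e)) (·-identity e)
    dense : ∃ λ d → d ≢ D.e
    dense = nontrivial-dense A⊆K₈
    d = proj₁ (proj₁ dense)
    -- At x the first factor is 1, so `bothZero⇒boolean` would force the dense element d ≠ 1 to be
    -- 1.
    ρ : ℕ → Carrier
    ρ zero    = x
    ρ (suc _) = d
    d≡e : Sat A bothZero⇒boolean → d ≡ e
    d≡e sat = trans (sym (trans (cong₂ _·_ bothZero≡e (DensePart.densify-g densePartOf (proj₁ dense))) (·-identity d)))
                (trans (sat ρ) bothZero≡e)
    refute : (∀ C → Mod Γ C → ∀ ε → ThK₈ ε → Sat C ε) ⊎ (∀ ε → Γ ε → Sat A ε) → ⊥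
    -- `K₄` is a model of Γ outside V(K₈).
    refute (inj₁ K₈⊆Γ) = ¬SatK₄-neverBothZero (K₈⊆Γ K₄ (λ ε → proj₂) neverBothZero
      (Sat₀𝟚⇒ThK₈ neverBothZero (Sat₀-neverBothZero 𝟚-integral)))
    refute (inj₂ Γ⊆A)  = proj₂ dense (dense-≡ (d≡e (Γ⊆A bothZero⇒boolean
      (Sat₀𝟚⇒ThK₈ bothZero⇒boolean (Sat₀-bothZero⇒boolean 𝟚-integral) , SatK₄-bothZero⇒boolean))))

  represent-nonzero : CoversV (Sat A) ThK₈ → ∀ x → NonZero₂ (to represent x)
  represent-nonzero cover x = nonzero (to represent x) (represent-realizes x)
    where
    nonzero : ∀ p → Realizes x p → NonZero₂ p
    nonzero (just _  , _      ) _    = tt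
    nonzero (nothing , just _ ) _    = tt
    nonzero (nothing , nothing) real = represent-≢zero cover real

sameTheory : ∀ {A D} → Integral D → IsoToSub A (K (2⊕ D)) (K₀ (2⊕ D)) → SameTheory A D
sameTheory int iso = record { down = SatIso⇒Sat₀ int iso ; up = Sat₀⇒SatIso int iso }

theorem3p16 : (A : Alg true) → InKSRL A → Finite A → SubdirectlyIrreducible A →
    ((CoversV (Sat A) ThK₈ × ¬ CoversV (Sat A) (Sat K₄))
    ⇔ (Σ (Alg false) λ D → IsCIRL D × Finite D × SubdirectlyIrreducible D
    × CoversV (Sat D) (Sat 𝟚) × IsoToSub A (K (2⊕ D)) (K₀ (2⊕ D))))
theorem3p16 A inKSRL finite si = mk⇔ forward backward
  where
  forward : CoversV (Sat A) ThK₈ × ¬ CoversV (Sat A) (Sat K₄) →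
            Σ (Alg false) λ D → IsCIRL D × Finite D × SubdirectlyIrreducible D
              × CoversV (Sat D) (Sat 𝟚) × IsoToSub A (K (2⊕ D)) (K₀ (2⊕ D))
  forward (cover , _) = denseAlg , denseAlg-isCIRL , denseAlg-finite ,
      denseAlg-SI (nontrivial-dense (proj₁ cover)) , cover-down int (sameTheory int A≅K₀) cover , A≅K₀
    where
    open StoneKLattice A inKSRL
    open FiniteSI A inKSRL finite si
    int = IsCIRL⇒Integral denseAlg-isCIRL
    A≅K₀ = iso (represent-nonzero cover)
  backward : (Σ (Alg false) λ D → IsCIRL D × Finite D × SubdirectlyIrreducible D
               × CoversV (Sat D) (Sat 𝟚) × IsoToSub A (K (2⊕ D)) (K₀ (2⊕ D))) →
             CoversV (Sat A) ThK₈ × ¬ CoversV (Sat A) (Sat K₄)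
  backward (D , isCIRL , _ , _ , cover , A≅K₀) = cover-up int same inKSRL cover , not-cover-K₄ int same
    where
    int = IsCIRL⇒Integral isCIRL
    same = sameTheory int A≅K₀
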